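{- Let $p>2$ be a prime, let $t$ be a positive divisor of $p-1$, let $k>1$ be an integer and let $s\in\mathbb{N}$. Put $r=r_2(k)=\left\lfloor\frac{\log(p/2)}{8\log k}-\frac14\right\rfloor$. Then $$\#V(k,t,1)\le\max\left(2\tilde\Phi(k,s-1),\ \binom{r+s}{s}^{ -1}t\right).$$
   Context: $\mathbb{F}_p$ is the field of residues modulo $p$. For $x\in\mathbb{F}_p$, the rational height is $\|x\|=\min\{\max(|a|,b)~:~a\in\mathbb{Z},\ b\in\mathbb{N},\ a\equiv bx \pmod p\}$. For $t\mid p-1$, $G$ is the unique subgroup of $\mathbb{F}_p^*$ of order $t$ and $V(k,t,1)=\{x\in G~:~\|x\|\le k\}$. $\Psi(x,y)$ is the number of positive integers $n\le x$ all of whose prime factors are at most $y$; $p_j$ is the $j$-th prime ($p_1=2$), with the convention $\Psi(x,p_0)=1$ for $x\ge 1$. For $m\in\mathbb{N}$, $\tilde\Phi(x,m)=\sum_{i=0}^{m}\binom{m}{i}\Psi(x,p_i)\Psi(x,p_{m-i})$, and $\tilde\Phi(x,0)=1$. -}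

module Defs where

open import Data.Bool using (Bool; true; false; _∧_; _∨_; not; if_then_else_)
open import Data.Nat using (ℕ; zero; suc; _+_; _*_; _∸_; _^_; _≤_; _<_; _%_; NonZero)
open import Data.Nat.Properties using (_≤?_)
open import Data.Nat.Divisibility using (_∣?_)
open import Data.Nat.Primality using (Prime; prime?)
open import Data.Nat.Combinatorics using (_C_)
open import Data.Integer as ℤ using (ℤ; +_; -[1+_]; ∣_∣)
open import Data.Integer.Divisibility as ℤD using ()
open import Data.List using (List; []; _∷_; length; filter; map; upTo)
open import Data.Nat.ListAction using (sum)
open import Data.List using (foldr)
open import Data.List.Membership.Propositional using (_∈_)
open import Data.List.Relation.Unary.Unique.Propositional using (Unique)
open import Data.Product using (Σ; ∃; ∃-syntax; _×_; _,_)
open import Data.Sum using (_⊎_)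
open import Function.Bundles using (_⇔_)
open import Relation.Binary.PropositionalEquality using (_≡_)
open import Relation.Nullary using (does)

-- Rational height in F_p.  Elements of F_p are represented by residues
-- x ∈ {0,…,p-1}.  ‖x‖ ≤ k  iff there are a ∈ ℤ, b ∈ ℕ = {1,2,…} with
-- a ≡ b x (mod p) and max(|a|, b) ≤ k  (unfolding of the minimum).

HeightLe : (p k x : ℕ) → Set
HeightLe p k x =
  ∃[ a ] ∃[ b ] (1 ≤ b × ∣ a ∣ ≤ k × b ≤ k × (+ p) ℤD.∣ (a ℤ.- + (b * x)))

ModEq : ℕ → ℕ → ℕ → Set
ModEq p a b = (+ p) ℤD.∣ (+ a ℤ.- + b)

record IsSubgroupOfOrder (p t : ℕ) (H : ℕ → Set) : Set₁ where
  field
    inUnits : ∀ x → H x → 1 ≤ x × x < p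
    hasOne  : H 1
    mulClosed : ∀ x y z → H x → H y → z < p → ModEq p (x * y) z → H z
    invClosed : ∀ x → H x → ∃[ y ] (H y × ModEq p (x * y) 1)
    order   : ∃[ L ] (Unique L × (∀ x → (x ∈ L) ⇔ H x) × length L ≡ t)

InV : (p k : ℕ) (H : ℕ → Set) → ℕ → Set
InV p k H x = H x × HeightLe p k x

isPrimeB : ℕ → Bool
isPrimeB n = does (prime? n)

-- first prime in [start, start+fuel), or start if none (never happens below)
searchPrime : ℕ → ℕ → ℕ
searchPrime zero start = start
searchPrime (suc fuel) start =
  if isPrimeB start then start else searchPrime fuel (suc start)

factorial : ℕ → ℕ
factorial zero = 1
factorial (suc n) = suc n * factorial n

-- least prime > n  (one exists in (n, n!+1], by Euclid)
nextPrime : ℕ → ℕ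
nextPrime n = searchPrime (factorial n + 1) (suc n)

-- nthPrime j = p_j for j ≥ 1 (p_1 = 2); the value at 0 is unused.
nthPrime : ℕ → ℕ
nthPrime zero = 1
nthPrime (suc zero) = 2
nthPrime (suc (suc j)) = nextPrime (nthPrime (suc j))

allB : (ℕ → Bool) → List ℕ → Bool
allB f = foldr (λ q b → f q ∧ b) true

smoothB : ℕ → ℕ → Bool
smoothB y n = allB (λ q → not (isPrimeB q ∧ does (q ∣? n)) ∨ does (q ≤? y)) (upTo (suc n))

Ψ : ℕ → ℕ → ℕ
Ψ x y = length (Data.List.filter (λ n → Relation.Nullary.Decidable.Core.T? (smoothB y n)) (map suc (upTo x)))
  where import Relation.Nullary.Decidable.Core

Ψp : ℕ → ℕ → ℕ
Ψp x zero = 1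
Ψp x (suc i) = Ψ x (nthPrime (suc i))

Φ̃ : ℕ → ℕ → ℕ
Φ̃ x m = sum (map (λ i → (m C i) * Ψp x i * Ψp x (m ∸ i)) (upTo (suc m)))

-- r = r₂(k) = ⌊ log(p/2)/(8 log k) - 1/4 ⌋, characterised exactly:
-- for integer r, r ≤ log(p/2)/(8 log k) - 1/4 < r+1  iff
-- 2k^(8r+2) ≤ p < 2k^(8r+10).  For p ≥ 3 this forces r ≥ -1, and
-- r = -1 iff p < 2k².

IsR2 : (p k : ℕ) → ℤ → Set
IsR2 p k r =
  (r ≡ -[1+ 0 ] × p < 2 * k ^ 2)
  ⊎ (∃[ n ] (r ≡ + n × 2 * k ^ (8 * n + 2) ≤ p × p < 2 * k ^ (8 * n + 10)))

-- binomial coefficient with integer upper entry; equals 0 when the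
-- upper entry is < the lower one (only nonnegative entries occur here).
binomℤ : ℤ → ℕ → ℕ
binomℤ (+ n) s = n C s
binomℤ -[1+ _ ] s = 0

{-# OPTIONS --safe #-}
-- Lift every x ∈ V(k,t,1) to a fraction a/b with |a|, b ≤ k.  Gaussian elimination on the
-- q-adic valuations yields fractions ξ₁, ξ₂, … and additive functionals f₁, f₂, … such that fᵢ
-- vanishes on ξⱼ for j < i and |fᵢ| is maximal over V at ξᵢ.
-- If s of them are found, the products v ξ₁^{3n₁} ⋯ ξₛ^{3nₛ} with v ∈ V and n₁ + ⋯ + nₛ ≤ r are
-- pairwise distinct rationals, since fᵢ separates different values of nᵢ (3 > 2); as p ≥ 2k^{8r+2},
-- they are still distinct modulo p, and they all lie in G, whence C(r+s,s) #V ≤ t.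
-- Otherwise fewer than s pivot primes determine a/b up to sign.  Splitting them into the i primes
-- with positive exponent and the others, and replacing the primes of each part by the first primes
-- in the same order, which decreases numerator and denominator, gives #V ≤ 2 Φ̃(k, s-1).
module Submission where

open import Defs
open import Algebra.Bundles using (module AbelianGroup)
open import Algebra.Properties.CommutativeSemigroup using (interchange)
open import Algebra.Properties.Group using (∙-cancelʳ)
open import Data.Bool using (T; _∧_; _∨_; not)
open import Data.Bool.Properties using (T-∧)
open import Data.Integer as ℤ using (ℤ; +_; ∣_∣; 0ℤ; _◃_)
import Data.Integer.Divisibility.Signed as ℤ∣
import Data.Integer.Properties as ℤ
open import Data.Integer.Tactic.RingSolver using (solve-∀)
open import Data.List using (List; []; _∷_; _++_; length; filter; map; upTo; applyUpTo; concatMap; cartesianProduct)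
open import Data.List.Extrema.Nat using (argmax; argmax-sel; f[xs]≤f[argmax])
open import Data.List.Membership.Propositional using (_∈_; _∉_; find; lose)
open import Data.List.Membership.Propositional.Properties
open import Data.List.Properties using (filter-++; filter-accept; filter-reject; filter-none; length-++; length-map; map-++; map-∘; map-cong; map-upTo)
open import Data.List.Relation.Binary.Permutation.Propositional using (_↭_; ↭-reflexive; ↭-refl; ↭-sym; ↭-trans; prep; swap)
open import Data.List.Relation.Binary.Permutation.Propositional.Properties using (All-resp-↭; ∈-resp-↭; shift; filter-↭; ↭-length)
open import Data.List.Relation.Binary.Subset.Propositional using (_⊆_)
open import Data.List.Relation.Unary.All as All using (All; []; _∷_)
import Data.List.Relation.Unary.All.Properties as All
open import Data.List.Relation.Unary.AllPairs as AllPairs using (AllPairs; []; _∷_)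
import Data.List.Relation.Unary.AllPairs.Properties as AllPairs
open import Data.List.Relation.Unary.Any as Any using (here; there; any?)
open import Data.List.Relation.Unary.Unique.Propositional using (Unique)
import Data.List.Relation.Unary.Unique.Propositional.Properties as Unique
open import Data.Nat
open import Data.Nat.Combinatorics using (_C_; nCk+nC[k+1]≡[n+1]C[k+1]; nCn≡1; k>n⇒nCk≡0)
open import Data.Nat.Divisibility using (_∣_; _∤_; _∣?_; ∣1⇒≡1; ∣m+n∣m⇒∣n; ∣n⇒∣m*n; ∣⇒≤; >⇒∤; m∣m*n)
open import Data.Nat.DivMod using (m≡m%n+[m/n]*n; m%n<n)
open import Data.Nat.ListAction using (sum; product)
open import Data.Nat.ListAction.Properties using (sum-++; product-++; product-↭; ∈⇒∣product)
open import Data.Nat.Primality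
open import Data.Nat.Primality.Factorisation
open import Data.Nat.Properties
import Data.Nat.Tactic.RingSolver as ℕ-Solver
open import Data.Product using (∃-syntax; _×_; _,_; proj₁; proj₂)
open import Data.Sign as Sign using (Sign)
import Data.Sign.Properties as Sign
open import Data.Sum using (_⊎_; inj₁; inj₂)
open import Data.Vec as Vec using (Vec; []; _∷_)
open import Data.Vec.Properties using (∷-injectiveʳ)
open import Function using (_∘_; _⇔_; Equivalence)
open import Relation.Binary.Definitions using (tri<; tri≈; tri>)
open import Relation.Binary.PropositionalEquality
open import Relation.Nullary using (¬_; yes; no; contradiction; ¬?; does)
open import Relation.Nullary.Decidable using (T?; _×-dec_; decidable-stable)
open import Relation.Unary using (Decidable)

-- The obstacle to reading off an exponent nᵢ is the unknown factor v of each product, whose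
-- valuations need not vanish. Since fᵢ is paired with a fraction at which |fᵢ| is largest, its
-- values at two elements of V differ by at most 2|fᵢ(ξᵢ)|, whereas changing nᵢ shifts fᵢ by a
-- nonzero multiple of 3fᵢ(ξᵢ). The vanishing on earlier fractions makes the system triangular: the
-- exponent of the newest fraction is read off in ℚ, its power is cancelled in the group, and a
-- product over a shorter list remains. A single valuation need not vanish on the earlier fractions,
-- hence the elimination. It proceeds by cross multiplication instead of division, so every
-- functional is an integer combination of valuations. Fractions are never reduced. Common factors
-- of a and b disappear only in the differences of valuations, and the height of a product is
-- controlled by counting its factors.

open PrimeFactorisation using (isFactorisation; factorsPrime)

-- Multiplicities in prime lists and valuations.

count : ℕ → List ℕ → ℕ
count q ns = length (filter (q ≟_) ns)

count-++ : ∀ q ms ns → count q (ms ++ ns) ≡ count q ms + count q ns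
count-++ q ms ns = trans (cong length (filter-++ (q ≟_) ms ns)) (length-++ (filter (q ≟_) ms))

count-↭ : ∀ q {ms ns} → ms ↭ ns → count q ms ≡ count q ns
count-↭ q ms↭ns = ↭-length (filter-↭ (q ≟_) ms↭ns)

count-here : ∀ {q n} ns → q ≡ n → count q (n ∷ ns) ≡ suc (count q ns)
count-here {q} ns q≡n = cong length (filter-accept (q ≟_) q≡n)

count-there : ∀ {q n} ns → q ≢ n → count q (n ∷ ns) ≡ count q ns
count-there {q} ns q≢n = cong length (filter-reject (q ≟_) q≢n)

count-tail : ∀ q n {ms ns} → count q (n ∷ ms) ≡ count q (n ∷ ns) → count q ms ≡ count q ns
count-tail q n {ms} {ns} eq with q ≟ n
... | yes q≡n = suc-injective (trans (sym (count-here ms q≡n)) (trans eq (count-here ns q≡n)))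
... | no q≢n  = trans (sym (count-there ms q≢n)) (trans eq (count-there ns q≢n))

count≢0⇒∈ : ∀ q ns {c} → count q ns ≡ suc c → q ∈ ns
count≢0⇒∈ q (n ∷ ns) eq with q ≟ n
... | yes q≡n = here q≡n
... | no q≢n  = there (count≢0⇒∈ q ns (trans (sym (count-there ns q≢n)) eq))

∉⇒count≡0 : ∀ {q ns} → q ∉ ns → count q ns ≡ 0
∉⇒count≡0 {q} {ns} q∉ns = cong length (filter-none (q ≟_) (All.¬Any⇒All¬ ns q∉ns))

∈⇒↭∷ : ∀ {A : Set} {n : A} {ns} → n ∈ ns → ∃[ ms ] ns ↭ n ∷ ms
∈⇒↭∷ n∈ns with ys , zs , eq ← ∈-∃++ n∈ns = ys ++ zs , ↭-trans (↭-reflexive eq) (shift _ ys zs)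

-- The head of one list must occur in the other; removing it from both preserves the equality of
-- multiplicities. Testing prime `q` suffices because all entries are prime.
product-count-injective : ∀ {ms ns} → All Prime ms → All Prime ns →
  (∀ q → Prime q → count q ms ≡ count q ns) → product ms ≡ product ns
product-count-injective {[]} {[]} _ _ _ = refl
product-count-injective {[]} {n ∷ ns} _ (n-prime ∷ _) eq =
  contradiction (trans (eq n n-prime) (count-here {n} ns refl)) 0≢1+n
product-count-injective {m ∷ ms} {ns} (m-prime ∷ ms-prime) ns-prime eq
  with ns′ , ns↭m∷ns′ ← ∈⇒↭∷ (count≢0⇒∈ m ns (trans (sym (eq m m-prime)) (count-here {m} ms refl))) =
  trans (cong (m *_) (product-count-injective ms-prime (All.tail (All-resp-↭ ns↭m∷ns′ ns-prime))
          λ q q-prime → count-tail q m (trans (eq q q-prime) (count-↭ q ns↭m∷ns′))))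
        (sym (product-↭ ns↭m∷ns′))

primePowers : (ℕ → ℕ) → List ℕ → ℕ
primePowers e qs = product (map (λ q → q ^ e q) qs)

primePowers-cong : ∀ {e e′} qs → All (λ q → e q ≡ e′ q) qs → primePowers e qs ≡ primePowers e′ qs
primePowers-cong [] [] = refl
primePowers-cong (q ∷ qs) (eq ∷ eqs) = cong₂ _*_ (cong (q ^_) eq) (primePowers-cong qs eqs)

primePowers-mono : ∀ {e e′ qs} → All Prime qs → (∀ q → e q ≤ e′ q) → primePowers e qs ≤ primePowers e′ qs
primePowers-mono [] _ = ≤-refl
primePowers-mono {qs = q ∷ _} (q-prime ∷ qs-prime) e≤e′ =
  *-mono-≤ (^-monoʳ-≤ q {{prime⇒nonZero q-prime}} (e≤e′ q)) (primePowers-mono qs-prime e≤e′)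

-- As `qs` has no repetitions, the new entry `n` changes at most one factor, and multiplies it by
-- `n`. The inequality is strict when `n` is missing from `qs` and exceeds 1.
primePowers-count-∷ : ∀ n ns {qs} → .{{NonZero n}} → Unique qs →
  primePowers (λ q → count q (n ∷ ns)) qs ≤ n * primePowers (λ q → count q ns) qs
primePowers-count-∷ n ns [] = ≤-trans (>-nonZero⁻¹ n) (≤-reflexive (sym (*-identityʳ n)))
primePowers-count-∷ n ns {q ∷ qs} (q≢qs ∷ qs!) with q ≟ n
... | yes refl = ≤-reflexive (trans
        (cong₂ _*_ (cong (q ^_) (count-here ns refl))
          (primePowers-cong qs (All.map (λ q≢q′ → count-there ns (q≢q′ ∘ sym)) q≢qs)))
        (*-assoc q _ _))
... | no q≢n = begin
        q ^ count q (n ∷ ns) * primePowers (λ q → count q (n ∷ ns)) qs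
          ≡⟨ cong (λ c → q ^ c * primePowers (λ q → count q (n ∷ ns)) qs) (count-there ns q≢n) ⟩
        q ^ count q ns * primePowers (λ q → count q (n ∷ ns)) qs
          ≤⟨ *-monoʳ-≤ (q ^ count q ns) (primePowers-count-∷ n ns qs!) ⟩
        q ^ count q ns * (n * rest)   ≡⟨ *-assoc (q ^ count q ns) n rest ⟨
        q ^ count q ns * n * rest     ≡⟨ cong (_* rest) (*-comm (q ^ count q ns) n) ⟩
        n * q ^ count q ns * rest     ≡⟨ *-assoc n _ rest ⟩
        n * (q ^ count q ns * rest)   ∎
  where open ≤-Reasoning
        rest = primePowers (λ q → count q ns) qs

primePowers-count≤product : ∀ {ns qs} → All Prime ns → Unique qs →
  primePowers (λ q → count q ns) qs ≤ product ns
primePowers-count≤product {[]} {qs} _ _ = ≤-reflexive (all-ones qs)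
  where
  all-ones : ∀ qs → primePowers (λ _ → 0) qs ≡ 1
  all-ones [] = refl
  all-ones (_ ∷ qs) = trans (+-identityʳ _) (all-ones qs)
primePowers-count≤product {n ∷ ns} (n-prime ∷ ns-prime) qs! =
  ≤-trans (primePowers-count-∷ n ns {{prime⇒nonZero n-prime}} qs!)
          (*-monoʳ-≤ n (primePowers-count≤product ns-prime qs!))

-- The value at n = 0 is junk.
v : ℕ → ℕ → ℕ
v q zero      = 0
v q n@(suc _) = count q (factors (factorise n))

-- Unique factorisation makes the valuation independent of the prime list, so additivity can be read
-- off from the concatenation of two such lists.
v-factorisation : ∀ q {n} .{{_ : NonZero n}} (f : PrimeFactorisation n) → v q n ≡ count q (factors f)
v-factorisation q {suc _} f = count-↭ q (factorisationUnique (factorise _) f)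

v-* : ∀ q m n .{{_ : NonZero m}} .{{_ : NonZero n}} → v q (m * n) ≡ v q m + v q n
v-* q m@(suc _) n@(suc _) = trans (v-factorisation q {m * n} mn) (count-++ q ms ns)
  where
  ms = factors (factorise m)
  ns = factors (factorise n)
  mn : PrimeFactorisation (m * n)
  mn = record
    { factors = ms ++ ns
    ; isFactorisation = trans (cong₂ _*_ (isFactorisation (factorise m)) (isFactorisation (factorise n)))
                              (sym (product-++ ms ns))
    ; factorsPrime = All.++⁺ (factorsPrime (factorise m)) (factorsPrime (factorise n))
    }

∤⇒v≡0 : ∀ {q} n .{{_ : NonZero n}} → q ∤ n → v q n ≡ 0
∤⇒v≡0 {q} n@(suc _) q∤n = ∉⇒count≡0 {ns = factors (factorise n)} λ q∈ →
  q∤n (subst (q ∣_) (sym (isFactorisation (factorise n))) (∈⇒∣product q∈))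

v-^ : ∀ {q} e → Prime q → v q (q ^ e) ≡ e
v-^ {q} zero q-prime = ∤⇒v≡0 1 λ q∣1 → ¬prime[1] (subst Prime (∣1⇒≡1 q∣1) q-prime)
v-^ {q} (suc e) q-prime = trans (v-* q q (q ^ e))
  (cong₂ _+_ (trans (v-factorisation q (primeFactorisation[p] q-prime)) (count-here {q} [] refl)) (v-^ e q-prime))
  where instance _ = prime⇒nonZero q-prime
                 _ = m^n≢0 q e

v-injective : ∀ m n .{{_ : NonZero m}} .{{_ : NonZero n}} → (∀ q → Prime q → v q m ≡ v q n) → m ≡ n
v-injective m@(suc _) n@(suc _) eq = trans (isFactorisation (factorise m)) (trans
  (product-count-injective (factorsPrime (factorise m)) (factorsPrime (factorise n)) eq)
  (sym (isFactorisation (factorise n))))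

primePowers-v≤ : ∀ n {qs} .{{_ : NonZero n}} → Unique qs → primePowers (λ q → v q n) qs ≤ n
primePowers-v≤ n@(suc _) qs! = ≤-trans (primePowers-count≤product (factorsPrime (factorise n)) qs!)
  (≤-reflexive (sym (isFactorisation (factorise n))))

-- Euclid's theorem and the sequence of primes.

prime-divisor : ∀ n → 1 < n → ∃[ q ] (Prime q × q ∣ n)
prime-divisor n@(suc _) 1<n with factorise n
... | record { factors = [] ; isFactorisation = n≡1 } = contradiction (sym n≡1) (<⇒≢ 1<n)
... | record { factors = q ∷ qs ; isFactorisation = n≡ ; factorsPrime = q-prime ∷ _ } =
  q , q-prime , subst (q ∣_) (sym n≡) (m∣m*n (product qs))

∣factorial : ∀ {q n} .{{_ : NonZero q}} → q ≤ n → q ∣ factorial n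
∣factorial {suc _} {suc n} q≤1+n with m≤n⇒m<n∨m≡n q≤1+n
... | inj₁ q<1+n = ∣n⇒∣m*n (suc n) (∣factorial (≤-pred q<1+n))
... | inj₂ refl  = m∣m*n (factorial n)

1≤factorial : ∀ n → 1 ≤ factorial n
1≤factorial zero = ≤-refl
1≤factorial (suc n) = *-mono-≤ (s≤s (z≤n {n})) (1≤factorial n)

-- The upper bound places a prime inside the search range of `nextPrime`, whose fallback value is
-- therefore never returned.
euclid : ∀ n → ∃[ q ] (Prime q × n < q × q ≤ factorial n + 1)
euclid n with prime-divisor (factorial n + 1) (+-monoˡ-≤ 1 (1≤factorial n))
... | q , q-prime , q∣ = q , q-prime , ≰⇒> q≰n , ∣⇒≤ {{>-nonZero (m≤n+m 1 (factorial n))}} q∣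
  where
  q≰n : q ≰ n
  q≰n q≤n = ¬prime[1] (subst Prime
    (∣1⇒≡1 (∣m+n∣m⇒∣n q∣ (∣factorial {{prime⇒nonZero q-prime}} q≤n))) q-prime)

searchPrime-prime : ∀ fuel {q start} → Prime q → start ≤ q → q < start + fuel → Prime (searchPrime fuel start)
searchPrime-prime zero {q} {start} _ start≤q q<start+0 =
  contradiction (subst (q <_) (+-identityʳ start) q<start+0) (≤⇒≯ start≤q)
searchPrime-prime (suc fuel) {q} {start} q-prime start≤q q< with prime? start
... | yes start-prime = start-prime
... | no ¬start-prime = searchPrime-prime fuel q-prime
  (≤∧≢⇒< start≤q λ { refl → ¬start-prime q-prime }) (subst (q <_) (+-suc start fuel) q<)

searchPrime≥ : ∀ fuel start → start ≤ searchPrime fuel start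
searchPrime≥ zero start = ≤-refl
searchPrime≥ (suc fuel) start with prime? start
... | yes _ = ≤-refl
... | no _  = ≤-trans (n≤1+n start) (searchPrime≥ fuel (suc start))

searchPrime≤ : ∀ fuel {q start} → Prime q → start ≤ q → searchPrime fuel start ≤ q
searchPrime≤ zero _ start≤q = start≤q
searchPrime≤ (suc fuel) {q} {start} q-prime start≤q with prime? start
... | yes _ = start≤q
... | no ¬start-prime = searchPrime≤ fuel q-prime (≤∧≢⇒< start≤q λ { refl → ¬start-prime q-prime })

nextPrime-prime : ∀ n → Prime (nextPrime n)
nextPrime-prime n with q , q-prime , n<q , q≤ ← euclid n =
  searchPrime-prime (factorial n + 1) q-prime n<q (s≤s (≤-trans q≤ (m≤n+m _ n)))

nextPrime> : ∀ n → n < nextPrime n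
nextPrime> n = searchPrime≥ (factorial n + 1) (suc n)

nextPrime≤ : ∀ {n q} → Prime q → n < q → nextPrime n ≤ q
nextPrime≤ {n} = searchPrime≤ (factorial n + 1)

nthPrime-prime : ∀ j → Prime (nthPrime (suc j))
nthPrime-prime zero    = prime[2]
nthPrime-prime (suc j) = nextPrime-prime (nthPrime (suc j))

-- Finite counting: pigeonhole, splittings and exponent vectors.

-- A relation takes the place of a function because the applications send a residue to data of a
-- fraction that lifts it, and the lift is only known to exist.
pigeonhole : ∀ {A B : Set} (R : A → B → Set) {xs ys} → Unique xs →
  (∀ {x} → x ∈ xs → ∃[ y ] (y ∈ ys × R x y)) →
  (∀ {x x′ y} → x ∈ xs → x′ ∈ xs → R x y → R x′ y → x ≡ x′) → length xs ≤ length ys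
pigeonhole R [] _ _ = z≤n
pigeonhole R {x ∷ xs} {ys} (x≢xs ∷ xs!) total injective
  with y , y∈ys , Rxy ← total (here refl)
  with ys′ , ys↭ ← ∈⇒↭∷ y∈ys =
  subst (suc (length xs) ≤_) (sym (↭-length ys↭))
    (s≤s (pigeonhole R xs! total′ λ x∈ x′∈ → injective (there x∈) (there x′∈)))
  where
  total′ : ∀ {x′} → x′ ∈ xs → ∃[ y′ ] (y′ ∈ ys′ × R x′ y′)
  total′ x′∈xs with total (there x′∈xs)
  ... | y′ , y′∈ys , Rx′y′ with ∈-resp-↭ ys↭ y′∈ys
  ...   | here refl = contradiction (injective (here refl) (there x′∈xs) Rxy Rx′y′) (All.lookup x≢xs x′∈xs)
  ...   | there y′∈ys′ = y′ , y′∈ys′ , Rx′y′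

length-concatMap : ∀ {A B : Set} (f : A → List B) xs → length (concatMap f xs) ≡ sum (map (length ∘ f) xs)
length-concatMap f [] = refl
length-concatMap f (x ∷ xs) = trans (length-++ (f x)) (cong (_+_ (length (f x))) (length-concatMap f xs))

length-cartesianProduct : ∀ {A B : Set} (xs : List A) (ys : List B) →
  length (cartesianProduct xs ys) ≡ length xs * length ys
length-cartesianProduct [] ys = refl
length-cartesianProduct (x ∷ xs) ys = trans (length-++ (map (x ,_) ys))
  (cong₂ _+_ (length-map (x ,_) ys) (length-cartesianProduct xs ys))

sum-+ : ∀ (f g : ℕ → ℕ) n →
  sum (applyUpTo (λ i → f i + g i) n) ≡ sum (applyUpTo f n) + sum (applyUpTo g n)
sum-+ f g zero = refl
sum-+ f g (suc n) = trans (cong (_+_ (f 0 + g 0)) (sum-+ (f ∘ suc) (g ∘ suc) n))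
  (interchange +-commutativeSemigroup (f 0) (g 0) _ _)

sum-cong : ∀ {f g : ℕ → ℕ} n → (∀ {i} → i < n → f i ≡ g i) → sum (applyUpTo f n) ≡ sum (applyUpTo g n)
sum-cong zero _ = refl
sum-cong (suc n) eq = cong₂ _+_ (eq z<s) (sum-cong n (eq ∘ s<s))

sum-last : ∀ (f : ℕ → ℕ) n → sum (applyUpTo f (suc n)) ≡ sum (applyUpTo f n) + f n
sum-last f zero = +-identityʳ (f 0)
sum-last f (suc n) = trans (cong (_+_ (f 0)) (sum-last (f ∘ suc) n)) (sym (+-assoc (f 0) _ _))

splits : ∀ {A : Set} → List A → List (List A × List A)
splits [] = ([] , []) ∷ []
splits (x ∷ xs) = map (λ (ys , zs) → x ∷ ys , zs) (splits xs) ++ map (λ (ys , zs) → ys , x ∷ zs) (splits xs)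

filter∈splits : ∀ {A : Set} {P : A → Set} (P? : Decidable P) xs →
  (filter P? xs , filter (¬? ∘ P?) xs) ∈ splits xs
filter∈splits P? [] = here refl
filter∈splits P? (x ∷ xs) with P? x
... | yes _ = ∈-++⁺ˡ (∈-map⁺ _ (filter∈splits P? xs))
... | no _  = ∈-++⁺ʳ _ (∈-map⁺ _ (filter∈splits P? xs))

binomialSum : (ℕ → ℕ → ℕ) → ℕ → ℕ
binomialSum h m = sum (applyUpTo (λ i → (m C i) * h i (m ∸ i)) (suc m))

-- Pascal's rule under the sum: one further element joins either the first or the second part of a
-- splitting.
binomialSum-suc : ∀ h m →
  binomialSum (λ i j → h (suc i) j) m + binomialSum (λ i j → h i (suc j)) m ≡ binomialSum h (suc m)
binomialSum-suc h m = sym (begin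
  first + sum (applyUpTo (λ i → (suc m C suc i) * h (suc i) (m ∸ i)) (suc m))
    ≡⟨ cong (_+_ first) (sum-cong (suc m) λ {i} _ → trans
         (cong (_* h (suc i) (m ∸ i)) (sym (nCk+nC[k+1]≡[n+1]C[k+1] m i)))
         (*-distribʳ-+ (h (suc i) (m ∸ i)) (m C i) (m C suc i))) ⟩
  first + sum (applyUpTo (λ i → (m C i) * h (suc i) (m ∸ i) + next i) (suc m))
    ≡⟨ cong (_+_ first) (sum-+ (λ i → (m C i) * h (suc i) (m ∸ i)) next (suc m)) ⟩
  first + (left + sum (applyUpTo next (suc m)))
    ≡⟨ +-assoc first left _ ⟨
  first + left + sum (applyUpTo next (suc m))
    ≡⟨ cong (_+ sum (applyUpTo next (suc m))) (+-comm first left) ⟩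
  left + first + sum (applyUpTo next (suc m))
    ≡⟨ +-assoc left first _ ⟩
  -- `first` becomes the term of index 0 in front of the shifted sum of `next`. The term of index
  -- `suc m` is zero, since `m C suc m` is.
  left + sum (applyUpTo (λ i → (m C i) * h i (suc m ∸ i)) (suc (suc m)))
    ≡⟨ cong (_+_ left) (sum-last (λ i → (m C i) * h i (suc m ∸ i)) (suc m)) ⟩
  left + (sum (applyUpTo (λ i → (m C i) * h i (suc m ∸ i)) (suc m)) + (m C suc m) * h (suc m) (m ∸ m))
    ≡⟨ cong (_+_ left) (cong₂ _+_
         (sum-cong (suc m) λ {i} i<1+m → cong (λ j → (m C i) * h i j) (+-∸-assoc 1 (≤-pred i<1+m)))
         (cong (_* h (suc m) (m ∸ m)) (k>n⇒nCk≡0 (n<1+n m)))) ⟩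
  left + (right + 0)
    ≡⟨ cong (_+_ left) (+-identityʳ right) ⟩
  left + right ∎)
  where
  open ≡-Reasoning
  left = binomialSum (λ i j → h (suc i) j) m
  right = binomialSum (λ i j → h i (suc j)) m
  first = (suc m C 0) * h 0 (suc m)
  next : ℕ → ℕ
  next i = (m C suc i) * h (suc i) (m ∸ i)

sum-splits : ∀ {A : Set} (h : ℕ → ℕ → ℕ) (xs : List A) →
  sum (map (λ (ys , zs) → h (length ys) (length zs)) (splits xs)) ≡ binomialSum h (length xs)
sum-splits h [] = cong (_+ 0) (sym (+-identityʳ (h 0 0)))
sum-splits {A} h (x ∷ xs) = begin
  sum (map H (map (λ (ys , zs) → x ∷ ys , zs) ss ++ map (λ (ys , zs) → ys , x ∷ zs) ss))
    ≡⟨ cong sum (map-++ H (map (λ (ys , zs) → x ∷ ys , zs) ss) _) ⟩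
  sum (map H (map (λ (ys , zs) → x ∷ ys , zs) ss) ++ map H (map (λ (ys , zs) → ys , x ∷ zs) ss))
    ≡⟨ sum-++ (map H (map (λ (ys , zs) → x ∷ ys , zs) ss)) _ ⟩
  sum (map H (map (λ (ys , zs) → x ∷ ys , zs) ss)) + sum (map H (map (λ (ys , zs) → ys , x ∷ zs) ss))
    ≡⟨ cong₂ _+_ (cong sum (map-∘ ss)) (cong sum (map-∘ ss)) ⟨
  sum (map (λ (ys , zs) → h (suc (length ys)) (length zs)) ss)
    + sum (map (λ (ys , zs) → h (length ys) (suc (length zs))) ss)
    ≡⟨ cong₂ _+_ (sum-splits (λ i j → h (suc i) j) xs) (sum-splits (λ i j → h i (suc j)) xs) ⟩
  binomialSum (λ i j → h (suc i) j) (length xs) + binomialSum (λ i j → h i (suc j)) (length xs)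
    ≡⟨ binomialSum-suc h (length xs) ⟩
  binomialSum h (suc (length xs)) ∎
  where
  open ≡-Reasoning
  ss = splits xs
  H : List A × List A → ℕ
  H (ys , zs) = h (length ys) (length zs)

bump : ∀ {s} → Vec ℕ (suc s) → Vec ℕ (suc s)
bump (n ∷ ns) = suc n ∷ ns

exponents : ∀ s → ℕ → List (Vec ℕ s)
exponents zero r = [] ∷ []
exponents (suc s) zero = map (0 ∷_) (exponents s 0)
exponents (suc s) (suc r) = map bump (exponents (suc s) r) ++ map (0 ∷_) (exponents s (suc r))

length-exponents : ∀ s r → length (exponents s r) ≡ (r + s) C s
length-exponents zero r = refl
length-exponents (suc s) zero = begin
  length (map (0 ∷_) (exponents s 0)) ≡⟨ length-map (0 ∷_) (exponents s 0) ⟩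
  length (exponents s 0)              ≡⟨ length-exponents s 0 ⟩
  s C s                               ≡⟨ nCn≡1 s ⟩
  1                                   ≡⟨ nCn≡1 (suc s) ⟨
  suc s C suc s                       ∎
  where open ≡-Reasoning
length-exponents (suc s) (suc r) = begin
  length (map bump (exponents (suc s) r) ++ map (0 ∷_) (exponents s (suc r)))
    ≡⟨ length-++ (map bump (exponents (suc s) r)) ⟩
  length (map bump (exponents (suc s) r)) + length (map (0 ∷_) (exponents s (suc r)))
    ≡⟨ cong₂ _+_ (length-map bump (exponents (suc s) r)) (length-map (0 ∷_) (exponents s (suc r))) ⟩
  length (exponents (suc s) r) + length (exponents s (suc r))
    ≡⟨ cong₂ _+_ (length-exponents (suc s) r) (length-exponents s (suc r)) ⟩
  (r + suc s) C suc s + (suc r + s) C s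
    ≡⟨ cong (λ n → (r + suc s) C suc s + n C s) (+-suc r s) ⟨
  (r + suc s) C suc s + (r + suc s) C s
    ≡⟨ +-comm ((r + suc s) C suc s) _ ⟩
  (r + suc s) C s + (r + suc s) C suc s
    ≡⟨ nCk+nC[k+1]≡[n+1]C[k+1] (r + suc s) s ⟩
  suc (r + suc s) C suc s ∎
  where open ≡-Reasoning

exponents-unique : ∀ s r → Unique (exponents s r)
exponents-unique zero r = [] ∷ []
exponents-unique (suc s) zero = Unique.map⁺ ∷-injectiveʳ (exponents-unique s 0)
exponents-unique (suc s) (suc r) = Unique.++⁺
  (Unique.map⁺ bump-injective (exponents-unique (suc s) r))
  (Unique.map⁺ ∷-injectiveʳ (exponents-unique s (suc r))) disjoint
  where
  bump-injective : ∀ {s} {ms ns : Vec ℕ (suc s)} → bump ms ≡ bump ns → ms ≡ ns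
  bump-injective {ms = _ ∷ _} {_ ∷ _} refl = refl
  disjoint : ∀ {ns} → ¬ (ns ∈ map bump (exponents (suc s) r) × ns ∈ map (0 ∷_) (exponents s (suc r)))
  disjoint (∈₁ , ∈₂) with ∈-map⁻ bump ∈₁ | ∈-map⁻ (0 ∷_) ∈₂
  ... | (_ ∷ _) , _ , refl | _ , _ , ()

sum-exponents : ∀ s r {ns} → ns ∈ exponents s r → Vec.sum ns ≤ r
sum-exponents zero r (here refl) = z≤n
sum-exponents (suc s) zero ∈s with _ , ns∈ , refl ← ∈-map⁻ (0 ∷_) ∈s = sum-exponents s 0 ns∈
sum-exponents (suc s) (suc r) ∈s with ∈-++⁻ (map bump (exponents (suc s) r)) ∈s
... | inj₁ ∈₁ with (_ ∷ _) , ns∈ , refl ← ∈-map⁻ bump ∈₁ = s≤s (sum-exponents (suc s) r ns∈)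
... | inj₂ ∈₂ with _ , ns∈ , refl ← ∈-map⁻ (0 ∷_) ∈₂ = sum-exponents s (suc r) ns∈

-- Compression to the first primes, and the codes counted by `Φ̃`.

nthPrime-< : ∀ j → nthPrime j < nthPrime (suc j)
nthPrime-< zero    = ≤-refl
nthPrime-< (suc j) = nextPrime> (nthPrime (suc j))

nthPrime-nonZero : ∀ j → NonZero (nthPrime (suc j))
nthPrime-nonZero j = prime⇒nonZero (nthPrime-prime j)

-- Induction from the small end of the list: `q` exceeds the next entry, hence the prime already
-- bounded by it, and `nextPrime` yields the least prime with that property.
nthPrime≤head : ∀ {q qs} → All Prime (q ∷ qs) → AllPairs _>_ (q ∷ qs) → nthPrime (suc (length qs)) ≤ q
nthPrime≤head {qs = []} (q-prime ∷ _) _ = nonTrivial⇒n>1 _ {{prime⇒nonTrivial q-prime}}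
nthPrime≤head {qs = _ ∷ _} (q-prime ∷ qs-prime) ((q>q′ ∷ _) ∷ qs↘) =
  nextPrime≤ q-prime (≤-<-trans (nthPrime≤head qs-prime qs↘) q>q′)

prime∣^⇒∣ : ∀ {q} m e → Prime q → q ∣ m ^ e → q ∣ m
prime∣^⇒∣ m zero q-prime q∣1 = contradiction (subst Prime (∣1⇒≡1 q∣1) q-prime) ¬prime[1]
prime∣^⇒∣ m (suc e) q-prime q∣ with euclidsLemma m (m ^ e) q-prime q∣
... | inj₁ q∣m = q∣m
... | inj₂ q∣m^e = prime∣^⇒∣ m e q-prime q∣m^e

-- Replaces the primes of a decreasing list of length l by p_l, …, p_1.
compress : (ℕ → ℕ) → List ℕ → ℕ
compress e [] = 1
compress e (q ∷ qs) = nthPrime (suc (length qs)) ^ e q * compress e qs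

compress-nonZero : ∀ e qs → NonZero (compress e qs)
compress-nonZero e [] = _
compress-nonZero e (q ∷ qs) = m*n≢0 _ _ {{m^n≢0 _ (e q) {{nthPrime-nonZero (length qs)}}}} {{compress-nonZero e qs}}

-- This serves twice: it puts compressed integers among those counted by `Ψ`, and it shows that the
-- leading prime does not divide the remaining factor, so that its exponent can be recovered.
compress-smooth : ∀ {q} e qs → Prime q → q ∣ compress e qs → q ≤ nthPrime (length qs)
compress-smooth e [] q-prime q∣1 = contradiction (subst Prime (∣1⇒≡1 q∣1) q-prime) ¬prime[1]
compress-smooth {q} e (q′ ∷ qs) q-prime q∣ with euclidsLemma (nthPrime (suc (length qs)) ^ e q′) _ q-prime q∣
... | inj₁ q∣p^e = ∣⇒≤ {{nthPrime-nonZero (length qs)}} (prime∣^⇒∣ _ (e q′) q-prime q∣p^e)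
... | inj₂ q∣rest = ≤-trans (compress-smooth e qs q-prime q∣rest) (<⇒≤ (nthPrime-< (length qs)))

compress-injective : ∀ e e′ qs → compress e qs ≡ compress e′ qs → All (λ q → e q ≡ e′ q) qs
compress-injective e e′ [] _ = []
compress-injective e e′ (q ∷ qs) eq = e≡e′ ∷ compress-injective e e′ qs
  (*-cancelˡ-≡ _ _ (P ^ e q) {{m^n≢0 P (e q) {{P≢0}}}}
    (trans eq (cong (λ a → P ^ a * compress e′ qs) (sym e≡e′))))
  where
  P = nthPrime (suc (length qs))
  P≢0 = nthPrime-nonZero (length qs)
  P-prime = nthPrime-prime (length qs)
  v-compress : ∀ e → v P (compress e (q ∷ qs)) ≡ e q
  v-compress e = begin
    v P (P ^ e q * compress e qs)       ≡⟨ v-* P (P ^ e q) (compress e qs)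
                                             {{m^n≢0 P (e q) {{P≢0}}}} {{compress-nonZero e qs}} ⟩
    v P (P ^ e q) + v P (compress e qs) ≡⟨ cong₂ _+_ (v-^ (e q) P-prime)
                                             (∤⇒v≡0 (compress e qs) {{compress-nonZero e qs}}
                                               λ P∣ → ≤⇒≯ (compress-smooth e qs P-prime P∣) (nthPrime-< (length qs))) ⟩
    e q + 0                             ≡⟨ +-identityʳ (e q) ⟩
    e q                                 ∎
    where open ≡-Reasoning
  e≡e′ : e q ≡ e′ q
  e≡e′ = trans (sym (v-compress e)) (trans (cong (v P) eq) (v-compress e′))

compress≤primePowers : ∀ e {qs} → All Prime qs → AllPairs _>_ qs → compress e qs ≤ primePowers e qs
compress≤primePowers e [] [] = ≤-refl
compress≤primePowers e {q ∷ _} qs-prime@(_ ∷ qs-prime′) qs↘@(_ ∷ qs↘′) =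
  *-mono-≤ (^-monoˡ-≤ (e q) (nthPrime≤head qs-prime qs↘)) (compress≤primePowers e qs-prime′ qs↘′)

allB-intro : ∀ f ns → (∀ n → T (f n)) → T (allB f ns)
allB-intro f [] _ = _
allB-intro f (n ∷ ns) Tf = Equivalence.from T-∧ (Tf n , allB-intro f ns Tf)

smoothB-intro : ∀ {y n} → (∀ q → Prime q → q ∣ n → q ≤ y) → T (smoothB y n)
smoothB-intro {y} {n} smooth =
  allB-intro (λ q → not (isPrimeB q ∧ does (q ∣? n)) ∨ does (q ≤? y)) (upTo (suc n)) condition
  where
  condition : ∀ q → T (not (isPrimeB q ∧ does (q ∣? n)) ∨ does (q ≤? y))
  condition q with prime? q | q ∣? n
  ... | no _        | _       = _
  ... | yes _       | no _    = _
  ... | yes q-prime | yes q∣n = ≤⇒≤ᵇ (smooth q q-prime q∣n)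

-- An empty part of the pivots compresses to 1, which is the only integer counted by the convention
-- for p_0.
smooths : ℕ → ℕ → List ℕ
smooths k zero = 1 ∷ []
smooths k (suc i) = filter (λ n → T? (smoothB (nthPrime (suc i)) n)) (map suc (upTo k))

length-smooths : ∀ k i → length (smooths k i) ≡ Ψp k i
length-smooths k zero = refl
length-smooths k (suc i) = refl

compress∈smooths : ∀ {k} e qs → compress e qs ≤ k → compress e qs ∈ smooths k (length qs)
compress∈smooths e [] _ = here refl
compress∈smooths {k} e qs@(_ ∷ _) ≤k =
  ∈-filter⁺ (λ n → T? (smoothB (nthPrime (length qs)) n)) (∈-range (compress-nonZero e qs) ≤k)
    (smoothB-intro λ q → compress-smooth e qs)
  where
  ∈-range : ∀ {n} → NonZero n → n ≤ k → n ∈ map suc (upTo k)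
  ∈-range {suc n} _ n<k = ∈-map⁺ suc (∈-upTo⁺ n<k)

-- The numbers are the compressed numerator and denominator. The lists are kept as well, because
-- compression forgets which primes have been replaced.
Code : Set
Code = (List ℕ × List ℕ) × (ℕ × ℕ)

codesOver : ℕ → List ℕ × List ℕ → List Code
codesOver k (I , J) = map ((I , J) ,_) (cartesianProduct (smooths k (length I)) (smooths k (length J)))

codes : ℕ → List ℕ → List Code
codes k qs = concatMap (codesOver k) (splits qs)

length-codesOver : ∀ k s → length (codesOver k s) ≡ Ψp k (length (proj₁ s)) * Ψp k (length (proj₂ s))
length-codesOver k (I , J) = begin
  length (codesOver k (I , J))                              ≡⟨ length-map ((I , J) ,_) (cartesianProduct as bs) ⟩
  length (cartesianProduct as bs)                           ≡⟨ length-cartesianProduct as bs ⟩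
  length as * length bs                                     ≡⟨ cong₂ _*_ (length-smooths k (length I))
                                                                           (length-smooths k (length J)) ⟩
  Ψp k (length I) * Ψp k (length J)                         ∎
  where
  open ≡-Reasoning
  as = smooths k (length I)
  bs = smooths k (length J)

length-codes : ∀ k qs → length (codes k qs) ≡ Φ̃ k (length qs)
length-codes k qs = begin
  length (codes k qs)
    ≡⟨ length-concatMap (codesOver k) (splits qs) ⟩
  sum (map (length ∘ codesOver k) (splits qs))
    ≡⟨ cong sum (map-cong (length-codesOver k) (splits qs)) ⟩
  sum (map (λ s → Ψp k (length (proj₁ s)) * Ψp k (length (proj₂ s))) (splits qs))
    ≡⟨ sum-splits (λ i j → Ψp k i * Ψp k j) qs ⟩
  binomialSum (λ i j → Ψp k i * Ψp k j) m
    ≡⟨ sum-cong (suc m) (λ {i} _ → sym (*-assoc (m C i) (Ψp k i) (Ψp k (m ∸ i)))) ⟩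
  sum (applyUpTo (λ i → (m C i) * Ψp k i * Ψp k (m ∸ i)) (suc m))
    ≡⟨ cong sum (map-upTo (λ i → (m C i) * Ψp k i * Ψp k (m ∸ i)) (suc m)) ⟨
  Φ̃ k m ∎
  where
  open ≡-Reasoning
  m = length qs

∈-codes : ∀ {k qs I J a b} → (I , J) ∈ splits qs → a ∈ smooths k (length I) → b ∈ smooths k (length J) →
  ((I , J) , (a , b)) ∈ codes k qs
∈-codes {I = I} {J} IJ∈ a∈ b∈ = ∈-concatMap⁺ (codesOver _)
  (Any.map (λ { refl → ∈-map⁺ _ (∈-cartesianProduct⁺ a∈ b∈) }) IJ∈)

-- Additive functionals and fractions representing elements of the subgroup.

-- Restricting to nonzero arguments excludes the junk value of `v` at 0.
record Additive (f : ℕ → ℤ) : Set where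
  constructor additive
  field *-homo : ∀ m n .{{_ : NonZero m}} .{{_ : NonZero n}} → f (m * n) ≡ f m ℤ.+ f n

open Additive

-- Subtraction gives 3|m - n||c| = |w - u| ≤ 2|c|, so 3|m - n| ≤ 2. The tripled exponents of the
-- products exist for this step.
dominated-injective : ∀ {c u w : ℤ} m n → c ≢ 0ℤ → ∣ u ∣ ≤ ∣ c ∣ → ∣ w ∣ ≤ ∣ c ∣ →
  + (3 * m) ℤ.* c ℤ.+ u ≡ + (3 * n) ℤ.* c ℤ.+ w → m ≡ n
dominated-injective {c} {u} {w} m n c≢0 ∣u∣≤ ∣w∣≤ eq =
  ℤ.+-injective (ℤ.i-j≡0⇒i≡j (+ m) (+ n) (ℤ.∣i∣≡0⇒i≡0 (n<1⇒n≡0 (*-cancelˡ-< 3 _ 1 3∣d∣<3))))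
  where
  instance ∣c∣≢0 : NonZero ∣ c ∣
           ∣c∣≢0 = ≢-nonZero (λ eq → c≢0 (ℤ.∣i∣≡0⇒i≡0 eq))
  d = + m ℤ.- + n
  rearrange : ∀ a b c u w → a ℤ.* c ℤ.+ u ≡ b ℤ.* c ℤ.+ w → (a ℤ.- b) ℤ.* c ≡ w ℤ.- u
  rearrange a b c u w eq = trans (lhs a b c u) (trans (cong (ℤ._- (b ℤ.* c ℤ.+ u)) eq) (rhs b c u w))
    where
    lhs : ∀ a b c u → (a ℤ.- b) ℤ.* c ≡ (a ℤ.* c ℤ.+ u) ℤ.- (b ℤ.* c ℤ.+ u)
    lhs = solve-∀
    rhs : ∀ b c u w → (b ℤ.* c ℤ.+ w) ℤ.- (b ℤ.* c ℤ.+ u) ≡ w ℤ.- u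
    rhs = solve-∀
  3*-distrib : + (3 * m) ℤ.- + (3 * n) ≡ + 3 ℤ.* d
  3*-distrib = trans (cong₂ ℤ._-_ (ℤ.pos-* 3 m) (ℤ.pos-* 3 n)) (distrib (+ m) (+ n))
    where
    distrib : ∀ a b → + 3 ℤ.* a ℤ.- + 3 ℤ.* b ≡ + 3 ℤ.* (a ℤ.- b)
    distrib = solve-∀
  3∣d∣<3 : 3 * ∣ d ∣ < 3 * 1
  3∣d∣<3 = s≤s (*-cancelʳ-≤ (3 * ∣ d ∣) 2 ∣ c ∣ (begin
    3 * ∣ d ∣ * ∣ c ∣                        ≡⟨ cong (_* ∣ c ∣) (ℤ.abs-* (+ 3) d) ⟨
    ∣ + 3 ℤ.* d ∣ * ∣ c ∣                    ≡⟨ ℤ.abs-* (+ 3 ℤ.* d) c ⟨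
    ∣ + 3 ℤ.* d ℤ.* c ∣                      ≡⟨ cong (λ e → ∣ e ℤ.* c ∣) 3*-distrib ⟨
    ∣ (+ (3 * m) ℤ.- + (3 * n)) ℤ.* c ∣      ≡⟨ cong ∣_∣ (rearrange (+ (3 * m)) (+ (3 * n)) c u w eq) ⟩
    ∣ w ℤ.- u ∣                              ≤⟨ ℤ.∣i-j∣≤∣i∣+∣j∣ w u ⟩
    ∣ w ∣ + ∣ u ∣                            ≤⟨ +-mono-≤ ∣w∣≤ ∣u∣≤ ⟩
    ∣ c ∣ + ∣ c ∣                            ≡⟨ cong (_+_ ∣ c ∣) (+-identityʳ ∣ c ∣) ⟨
    2 * ∣ c ∣                                ∎))
    where open ≤-Reasoning

∣∧abs<⇒≡0 : ∀ {p i} → + p ℤ∣.∣ i → ∣ i ∣ < p → i ≡ 0ℤ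
∣∧abs<⇒≡0 {p} {i} p∣i ∣i∣<p with ∣ i ∣ in eq
... | zero  = ℤ.∣i∣≡0⇒i≡0 eq
... | suc n = contradiction (subst (p ∣_) eq (ℤ∣.∣⇒∣ᵤ p∣i)) (>⇒∤ ∣i∣<p)

module Fractions {p t k : ℕ} (p-prime : Prime p) .{{_ : NonZero k}}
  {H : ℕ → Set} (isSubgroup : IsSubgroupOfOrder p t H) where

  open IsSubgroupOfOrder isSubgroup

  private instance
    p≢0 : NonZero p
    p≢0 = prime⇒nonZero p-prime

  cancel-mod : ∀ {x y} c → p ∤ c → x < p → y < p → + p ℤ∣.∣ + c ℤ.* (+ x ℤ.- + y) → x ≡ y
  cancel-mod {x} {y} c p∤c x<p y<p p∣ with
    euclidsLemma c ∣ + x ℤ.- + y ∣ p-prime (subst (p ∣_) (ℤ.abs-* (+ c) (+ x ℤ.- + y)) (ℤ∣.∣⇒∣ᵤ p∣))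
  ... | inj₁ p∣c = contradiction p∣c p∤c
  ... | inj₂ p∣x-y = ℤ.+-injective (ℤ.i-j≡0⇒i≡j (+ x) (+ y) (∣∧abs<⇒≡0 (ℤ∣.∣ᵤ⇒∣ p∣x-y)
    (subst (_< p) (cong ∣_∣ (sym (ℤ.m-n≡m⊖n x y))) (≤-<-trans (ℤ.∣m⊝n∣≤m⊔n x y) (⊔-pres-<m x<p y<p)))))

  ≡-% : ∀ n → + p ℤ∣.∣ + n ℤ.- + (n % p)
  ≡-% n = ℤ∣.divides (+ (n / p)) (begin
    + n ℤ.- + (n % p)                               ≡⟨ cong (λ m → + m ℤ.- + (n % p)) (m≡m%n+[m/n]*n n p) ⟩
    + (n % p) ℤ.+ + (n / p * p) ℤ.- + (n % p)       ≡⟨ cancel (+ (n % p)) (+ (n / p * p)) ⟩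
    + (n / p * p)                                   ≡⟨ ℤ.pos-* (n / p) p ⟩
    + (n / p) ℤ.* + p                               ∎)
    where
    open ≡-Reasoning
    cancel : ∀ a b → a ℤ.+ b ℤ.- a ≡ b
    cancel = solve-∀

  -- `deg` counts the factors of height at most `k`: it is additive under products and bounds the
  -- height by `k ^ deg`. Numerator and denominator may have common factors.
  record Fraction : Set where
    field
      res deg den : ℕ
      num   : ℤ
      res∈H : H res
      num≢0 : NonZero ∣ num ∣
      den≢0 : NonZero den
      num≤  : ∣ num ∣ ≤ k ^ deg
      den≤  : den ≤ k ^ deg
      num≡  : + p ℤ∣.∣ num ℤ.- + den ℤ.* + res

    ∣num∣ : ℕ
    ∣num∣ = ∣ num ∣

    res<p : res < p
    res<p = proj₂ (inUnits res res∈H)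

    p∤res : p ∤ res
    p∤res = >⇒∤ {{>-nonZero (proj₁ (inUnits res res∈H))}} res<p

  open Fraction

  -- The extension of an additive `f` to nonzero rationals. It ignores the sign of the numerator,
  -- which is why the final count doubles.
  value : (ℕ → ℤ) → Fraction → ℤ
  value f ρ = f (∣num∣ ρ) ℤ.- f (den ρ)

  one : Fraction
  one = record
    { res = 1 ; deg = 0 ; den = 1 ; num = + 1 ; res∈H = hasOne ; num≢0 = _ ; den≢0 = _
    ; num≤ = ≤-refl ; den≤ = ≤-refl ; num≡ = ℤ∣.divides 0ℤ refl }

  infixl 7 _⊗_
  _⊗_ : Fraction → Fraction → Fraction
  ρ ⊗ σ = record
    { res   = res ρ * res σ % p
    ; deg   = deg ρ + deg σ
    ; den   = den ρ * den σ
    ; num   = num ρ ℤ.* num σ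
    ; res∈H = mulClosed (res ρ) (res σ) _ (res∈H ρ) (res∈H σ) (m%n<n _ p) (ℤ∣.∣⇒∣ᵤ (≡-% (res ρ * res σ)))
    ; num≢0 = subst NonZero (sym (ℤ.abs-* (num ρ) (num σ))) (m*n≢0 _ _ {{num≢0 ρ}} {{num≢0 σ}})
    ; den≢0 = m*n≢0 _ _ {{den≢0 ρ}} {{den≢0 σ}}
    ; num≤  = subst₂ _≤_ (sym (ℤ.abs-* (num ρ) (num σ))) (sym (^-distribˡ-+-* k (deg ρ) (deg σ)))
                (*-mono-≤ (num≤ ρ) (num≤ σ))
    ; den≤  = subst (_ ≤_) (sym (^-distribˡ-+-* k (deg ρ) (deg σ))) (*-mono-≤ (den≤ ρ) (den≤ σ))
    -- With z the residue of xy, the difference aa′ - bb′z equals a′(a - bx) + bx(a′ - b′y) + bb′(xy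
    -- - z), and `p` divides each summand.
    ; num≡  = subst (+ p ℤ∣.∣_) (sym expand)
                (ℤ∣.∣m∣n⇒∣m+n (ℤ∣.∣n⇒∣m*n (num σ) (num≡ ρ))
                  (ℤ∣.∣m∣n⇒∣m+n (ℤ∣.∣n⇒∣m*n (+ den ρ ℤ.* + res ρ) (num≡ σ))
                    (ℤ∣.∣n⇒∣m*n (+ den ρ ℤ.* + den σ) (≡-% (res ρ * res σ)))))
    }
    where
    identity : ∀ a a′ b b′ x y z → a ℤ.* a′ ℤ.- b ℤ.* b′ ℤ.* z ≡
      a′ ℤ.* (a ℤ.- b ℤ.* x) ℤ.+ (b ℤ.* x ℤ.* (a′ ℤ.- b′ ℤ.* y) ℤ.+ b ℤ.* b′ ℤ.* (x ℤ.* y ℤ.- z))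
    identity = solve-∀
    expand : num ρ ℤ.* num σ ℤ.- + (den ρ * den σ) ℤ.* + (res ρ * res σ % p) ≡
      num σ ℤ.* (num ρ ℤ.- + den ρ ℤ.* + res ρ) ℤ.+ (+ den ρ ℤ.* + res ρ ℤ.* (num σ ℤ.- + den σ ℤ.* + res σ)
        ℤ.+ + den ρ ℤ.* + den σ ℤ.* (+ (res ρ * res σ) ℤ.- + (res ρ * res σ % p)))
    expand = substitute (num ρ) (num σ) (+ den ρ) (+ den σ) (+ res ρ) (+ res σ) (+ (res ρ * res σ % p))
      (ℤ.pos-* (den ρ) (den σ)) (ℤ.pos-* (res ρ) (res σ))
      where
      substitute : ∀ a a′ b b′ x y z {d w} → d ≡ b ℤ.* b′ → w ≡ x ℤ.* y → a ℤ.* a′ ℤ.- d ℤ.* z ≡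
        a′ ℤ.* (a ℤ.- b ℤ.* x) ℤ.+ (b ℤ.* x ℤ.* (a′ ℤ.- b′ ℤ.* y) ℤ.+ b ℤ.* b′ ℤ.* (w ℤ.- z))
      substitute a a′ b b′ x y z refl refl = identity a a′ b b′ x y z

  value-one : ∀ f → value f one ≡ 0ℤ
  value-one f = ℤ.+-inverseʳ (f 1)

  value-⊗ : ∀ {f} → Additive f → ∀ ρ σ → value f (ρ ⊗ σ) ≡ value f ρ ℤ.+ value f σ
  value-⊗ {f} f-additive ρ σ = begin
    f ∣ num ρ ℤ.* num σ ∣ ℤ.- f (den ρ * den σ)
      ≡⟨ cong (λ n → f n ℤ.- f (den ρ * den σ)) (ℤ.abs-* (num ρ) (num σ)) ⟩
    f (∣num∣ ρ * ∣num∣ σ) ℤ.- f (den ρ * den σ)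
      ≡⟨ cong₂ ℤ._-_ (*-homo f-additive _ _ {{num≢0 ρ}} {{num≢0 σ}}) (*-homo f-additive _ _ {{den≢0 ρ}} {{den≢0 σ}}) ⟩
    (f (∣num∣ ρ) ℤ.+ f (∣num∣ σ)) ℤ.- (f (den ρ) ℤ.+ f (den σ))
      ≡⟨ regroup (f (∣num∣ ρ)) _ _ _ ⟩
    value f ρ ℤ.+ value f σ ∎
    where
    open ≡-Reasoning
    regroup : ∀ a b c d → (a ℤ.+ b) ℤ.- (c ℤ.+ d) ≡ (a ℤ.- c) ℤ.+ (b ℤ.- d)
    regroup = solve-∀

  abstract
    power : Fraction → ℕ → Fraction
    power ρ zero    = one
    power ρ (suc n) = ρ ⊗ power ρ n

    deg-power : ∀ ρ n → deg (power ρ n) ≡ n * deg ρ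
    deg-power ρ zero    = refl
    deg-power ρ (suc n) = cong (_+_ (deg ρ)) (deg-power ρ n)

    value-power : ∀ {f} → Additive f → ∀ ρ n → value f (power ρ n) ≡ + n ℤ.* value f ρ
    value-power {f} f-additive ρ zero = value-one f
    value-power {f} f-additive ρ (suc n) = begin
      value f (ρ ⊗ power ρ n)               ≡⟨ value-⊗ f-additive ρ (power ρ n) ⟩
      value f ρ ℤ.+ value f (power ρ n)     ≡⟨ cong (λ i → value f ρ ℤ.+ i) (value-power f-additive ρ n) ⟩
      value f ρ ℤ.+ + n ℤ.* value f ρ       ≡⟨ ℤ.suc-* (+ n) (value f ρ) ⟨
      + suc n ℤ.* value f ρ                 ∎
      where open ≡-Reasoning

  infix 4 _≃_
  _≃_ : Fraction → Fraction → Set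
  ρ ≃ σ = num ρ ℤ.* + den σ ≡ num σ ℤ.* + den ρ

  -- 2k^d ≠ p because p is odd.
  res≡⇒≃ : ∀ {d ρ σ} → 2 < p → 2 * k ^ d ≤ p → deg ρ + deg σ ≤ d → res ρ ≡ res σ → ρ ≃ σ
  res≡⇒≃ {d} {ρ} {σ} 2<p 2k^d≤p deg≤d res≡ =
    ℤ.i-j≡0⇒i≡j _ _ (∣∧abs<⇒≡0 p∣difference (≤-<-trans difference≤ (≤∧≢⇒< 2k^d≤p 2k^d≢p)))
    where
    difference = num ρ ℤ.* + den σ ℤ.- num σ ℤ.* + den ρ
    identity : ∀ a a′ b b′ x → b′ ℤ.* (a ℤ.- b ℤ.* x) ℤ.- b ℤ.* (a′ ℤ.- b′ ℤ.* x) ≡ a ℤ.* b′ ℤ.- a′ ℤ.* b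
    identity = solve-∀
    -- With x the common residue, b′(a - bx) - b(a′ - b′x) is a combination of the two congruences
    -- from which x drops out.
    p∣difference : + p ℤ∣.∣ difference
    p∣difference = subst (+ p ℤ∣.∣_) (identity (num ρ) (num σ) (+ den ρ) (+ den σ) (+ res ρ))
      (ℤ∣.∣m∣n⇒∣m-n (ℤ∣.∣n⇒∣m*n (+ den σ) (num≡ ρ))
        (ℤ∣.∣n⇒∣m*n (+ den ρ) (subst (λ x → + p ℤ∣.∣ num σ ℤ.- + den σ ℤ.* + x) (sym res≡) (num≡ σ))))
    difference≤ : ∣ difference ∣ ≤ 2 * k ^ d
    difference≤ = begin
      ∣ difference ∣
        ≤⟨ ℤ.∣i-j∣≤∣i∣+∣j∣ (num ρ ℤ.* + den σ) (num σ ℤ.* + den ρ) ⟩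
      ∣ num ρ ℤ.* + den σ ∣ + ∣ num σ ℤ.* + den ρ ∣
        ≡⟨ cong₂ _+_ (ℤ.abs-* (num ρ) (+ den σ)) (ℤ.abs-* (num σ) (+ den ρ)) ⟩
      ∣num∣ ρ * den σ + ∣num∣ σ * den ρ
        ≤⟨ +-mono-≤ (*-mono-≤ (num≤ ρ) (den≤ σ)) (*-mono-≤ (num≤ σ) (den≤ ρ)) ⟩
      k ^ deg ρ * k ^ deg σ + k ^ deg σ * k ^ deg ρ
        ≡⟨ cong (_+_ (k ^ deg ρ * k ^ deg σ)) (trans (*-comm (k ^ deg σ) _) (sym (+-identityʳ _))) ⟩
      2 * (k ^ deg ρ * k ^ deg σ)
        ≡⟨ cong (2 *_) (^-distribˡ-+-* k (deg ρ) (deg σ)) ⟨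
      2 * k ^ (deg ρ + deg σ)
        ≤⟨ *-monoʳ-≤ 2 (^-monoʳ-≤ k deg≤d) ⟩
      2 * k ^ d ∎
      where open ≤-Reasoning
    2k^d≢p : 2 * k ^ d ≢ p
    2k^d≢p refl with prime⇒irreducible p-prime (m∣m*n {2} (k ^ d))
    ... | inj₂ 2≡p = <⇒≢ 2<p 2≡p

  ≃⇒value≡ : ∀ {f} → Additive f → ∀ {ρ σ} → ρ ≃ σ → value f ρ ≡ value f σ
  ≃⇒value≡ {f} f-additive {ρ} {σ} ρ≃σ =
    rearrange (f (∣num∣ ρ)) (f (den σ)) (f (∣num∣ σ)) (f (den ρ)) (begin
      f (∣num∣ ρ) ℤ.+ f (den σ)   ≡⟨ *-homo f-additive _ _ {{num≢0 ρ}} {{den≢0 σ}} ⟨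
      f (∣num∣ ρ * den σ)       ≡⟨ cong f (trans (sym (ℤ.abs-* (num ρ) (+ den σ)))
                                      (trans (cong ∣_∣ ρ≃σ) (ℤ.abs-* (num σ) (+ den ρ)))) ⟩
      f (∣num∣ σ * den ρ)       ≡⟨ *-homo f-additive _ _ {{num≢0 σ}} {{den≢0 ρ}} ⟩
      f (∣num∣ σ) ℤ.+ f (den ρ)   ∎)
    where
    open ≡-Reasoning
    rearrange : ∀ a b c d → a ℤ.+ b ≡ c ℤ.+ d → a ℤ.- d ≡ c ℤ.- b
    rearrange a b c d eq = trans (lhs a b d) (trans (cong (λ i → i ℤ.- b ℤ.- d) eq) (rhs b c d))
      where
      lhs : ∀ a b d → a ℤ.- d ≡ a ℤ.+ b ℤ.- b ℤ.- d
      lhs = solve-∀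
      rhs : ∀ b c d → c ℤ.+ d ℤ.- b ℤ.- d ≡ c ℤ.- b
      rhs = solve-∀

  -- Combining the congruences gives p | bb′(x - x′). A denominator divisible by `p` would leave its
  -- residue undetermined.
  ≃⇒res≡ : ∀ {ρ σ} → p ∤ den ρ → p ∤ den σ → ρ ≃ σ → res ρ ≡ res σ
  ≃⇒res≡ {ρ} {σ} p∤b p∤b′ ρ≃σ = cancel-mod (den ρ * den σ) p∤bb′ (res<p ρ) (res<p σ)
    (subst (+ p ℤ∣.∣_) (trans (identity (num ρ) (num σ) (+ den ρ) (+ den σ) (+ res ρ) (+ res σ) ρ≃σ)
                      (cong (ℤ._* (+ res ρ ℤ.- + res σ)) (sym (ℤ.pos-* (den ρ) (den σ)))))
      (ℤ∣.∣m∣n⇒∣m-n (ℤ∣.∣n⇒∣m*n (+ den ρ) (num≡ σ)) (ℤ∣.∣n⇒∣m*n (+ den σ) (num≡ ρ))))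
    where
    p∤bb′ : p ∤ den ρ * den σ
    p∤bb′ p∣ with euclidsLemma (den ρ) (den σ) p-prime p∣
    ... | inj₁ p∣b  = p∤b p∣b
    ... | inj₂ p∣b′ = p∤b′ p∣b′
    identity : ∀ a a′ b b′ x x′ → a ℤ.* b′ ≡ a′ ℤ.* b →
      b ℤ.* (a′ ℤ.- b′ ℤ.* x′) ℤ.- b′ ℤ.* (a ℤ.- b ℤ.* x) ≡ b ℤ.* b′ ℤ.* (x ℤ.- x′)
    identity a a′ b b′ x x′ eq = trans (lhs a a′ b b′ x x′)
      (trans (cong (λ i → a′ ℤ.* b ℤ.- i ℤ.+ b ℤ.* b′ ℤ.* (x ℤ.- x′)) eq) (rhs a′ b b′ x x′))
      where
      lhs : ∀ a a′ b b′ x x′ → b ℤ.* (a′ ℤ.- b′ ℤ.* x′) ℤ.- b′ ℤ.* (a ℤ.- b ℤ.* x) ≡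
        a′ ℤ.* b ℤ.- a ℤ.* b′ ℤ.+ b ℤ.* b′ ℤ.* (x ℤ.- x′)
      lhs = solve-∀
      rhs : ∀ a′ b b′ x x′ → a′ ℤ.* b ℤ.- a′ ℤ.* b ℤ.+ b ℤ.* b′ ℤ.* (x ℤ.- x′) ≡ b ℤ.* b′ ℤ.* (x ℤ.- x′)
      rhs = solve-∀

  ⊗-cancelˡ-res : ∀ ρ σ τ → res (ρ ⊗ σ) ≡ res (ρ ⊗ τ) → res σ ≡ res τ
  ⊗-cancelˡ-res ρ σ τ eq = cancel-mod (res ρ) (p∤res ρ) (res<p σ) (res<p τ)
    (subst (+ p ℤ∣.∣_) (trans (drop (+ (res ρ * res σ)) (+ (res ρ * res τ)) (+ res (ρ ⊗ τ)))
        (trans (cong₂ ℤ._-_ (ℤ.pos-* (res ρ) (res σ)) (ℤ.pos-* (res ρ) (res τ)))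
          (factor (+ res ρ) (+ res σ) (+ res τ))))
      (ℤ∣.∣m∣n⇒∣m-n (subst (λ r → + p ℤ∣.∣ + (res ρ * res σ) ℤ.- + r) eq (≡-% (res ρ * res σ)))
        (≡-% (res ρ * res τ))))
    where
    drop : ∀ a b c → (a ℤ.- c) ℤ.- (b ℤ.- c) ≡ a ℤ.- b
    drop = solve-∀
    factor : ∀ x a b → x ℤ.* a ℤ.- x ℤ.* b ≡ x ℤ.* (a ℤ.- b)
    factor = solve-∀

  -- Products of powers along a chain are pairwise distinct.

  translate : Fraction → (ξs : List Fraction) → Vec ℕ (length ξs) → Fraction
  translate ρ [] [] = ρ
  translate ρ (ξ ∷ ξs) (n ∷ ns) = power ξ (3 * n) ⊗ translate ρ ξs ns

  deg-translate : ∀ ρ {ξs} → All (λ ξ → deg ξ ≡ 1) ξs → ∀ ns →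
    deg (translate ρ ξs ns) ≡ 3 * Vec.sum ns + deg ρ
  deg-translate ρ [] [] = refl
  deg-translate ρ {ξ ∷ ξs} (deg≡1 ∷ degs≡1) (n ∷ ns) = begin
    deg (power ξ (3 * n)) + deg (translate ρ ξs ns) ≡⟨ cong₂ _+_ (deg-power ξ (3 * n)) (deg-translate ρ degs≡1 ns) ⟩
    3 * n * deg ξ + (3 * Vec.sum ns + deg ρ)        ≡⟨ cong (λ d → 3 * n * d + (3 * Vec.sum ns + deg ρ)) deg≡1 ⟩
    3 * n * 1 + (3 * Vec.sum ns + deg ρ)            ≡⟨ cong (_+ (3 * Vec.sum ns + deg ρ)) (*-identityʳ (3 * n)) ⟩
    3 * n + (3 * Vec.sum ns + deg ρ)                ≡⟨ +-assoc (3 * n) _ _ ⟨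
    3 * n + 3 * Vec.sum ns + deg ρ                  ≡⟨ cong (_+ deg ρ) (*-distribˡ-+ 3 n (Vec.sum ns)) ⟨
    3 * (n + Vec.sum ns) + deg ρ                    ∎
    where open ≡-Reasoning

  value-translate : ∀ {f} → Additive f → ∀ ρ {ξs} → All (λ ξ → value f ξ ≡ 0ℤ) ξs → ∀ ns →
    value f (translate ρ ξs ns) ≡ value f ρ
  value-translate _ ρ [] [] = refl
  value-translate {f} f-additive ρ {ξ ∷ ξs} (zero≡ ∷ zeros) (n ∷ ns) = begin
    value f (power ξ (3 * n) ⊗ translate ρ ξs ns)
      ≡⟨ value-⊗ f-additive (power ξ (3 * n)) (translate ρ ξs ns) ⟩
    value f (power ξ (3 * n)) ℤ.+ value f (translate ρ ξs ns)
      ≡⟨ cong₂ ℤ._+_ (trans (value-power f-additive ξ (3 * n)) (cong (+ (3 * n) ℤ.*_) zero≡))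
                     (value-translate f-additive ρ zeros ns) ⟩
    + (3 * n) ℤ.* 0ℤ ℤ.+ value f ρ
      ≡⟨ cong (ℤ._+ value f ρ) (ℤ.*-zeroʳ (+ (3 * n))) ⟩
    0ℤ ℤ.+ value f ρ
      ≡⟨ ℤ.+-identityˡ (value f ρ) ⟩
    value f ρ ∎
    where open ≡-Reasoning

  -- The newest fraction stands at the head, so its functional vanishes on the whole tail and
  -- cancelling its power leaves a product over a chain again.
  data Chain (V : List Fraction) : List Fraction → Set where
    []  : Chain V []
    add : ∀ {f ξ ξs} → Additive f → ξ ∈ V → value f ξ ≢ 0ℤ →
          (∀ {ρ} → ρ ∈ V → ∣ value f ρ ∣ ≤ ∣ value f ξ ∣) →
          All (λ ζ → value f ζ ≡ 0ℤ) ξs → Chain V ξs → Chain V (ξ ∷ ξs)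

  chain-deg : ∀ {V ξs} → All (λ ρ → deg ρ ≡ 1) V → Chain V ξs → All (λ ξ → deg ξ ≡ 1) ξs
  chain-deg degs [] = []
  chain-deg degs (add _ ξ∈V _ _ _ chain) = All.lookup degs ξ∈V ∷ chain-deg degs chain

  module _ {V r} (2<p : 2 < p) (bound : 2 * k ^ (8 * r + 2) ≤ p) (degs : All (λ ρ → deg ρ ≡ 1) V) where

    translate-≃ : ∀ {ξs} → Chain V ξs → ∀ {ρ σ} → ρ ∈ V → σ ∈ V → ∀ ms ns → Vec.sum ms ≤ r → Vec.sum ns ≤ r →
      res (translate ρ ξs ms) ≡ res (translate σ ξs ns) → translate ρ ξs ms ≃ translate σ ξs ns
    translate-≃ {ξs} chain {ρ} {σ} ρ∈V σ∈V ms ns Σms≤r Σns≤r =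
      res≡⇒≃ {ρ = translate ρ ξs ms} {translate σ ξs ns} 2<p bound
        (≤-trans (+-mono-≤ (deg≤ ρ∈V ms Σms≤r) (deg≤ σ∈V ns Σns≤r)) (≤-reflexive (double r)))
      where
      -- A product has degree at most 3r + 1, hence at most 4r + 1; two such bounds add up to the
      -- exponent 8r + 2 of `bound`.
      deg≤ : ∀ {ρ} → ρ ∈ V → ∀ ns → Vec.sum ns ≤ r → deg (translate ρ ξs ns) ≤ 4 * r + 1
      deg≤ {ρ} ρ∈V ns Σns≤r = begin
        deg (translate ρ ξs ns)  ≡⟨ deg-translate ρ (chain-deg degs chain) ns ⟩
        3 * Vec.sum ns + deg ρ   ≡⟨ cong (_+_ (3 * Vec.sum ns)) (All.lookup degs ρ∈V) ⟩
        3 * Vec.sum ns + 1       ≤⟨ +-monoˡ-≤ 1 (*-mono-≤ (n≤1+n 3) Σns≤r) ⟩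
        4 * r + 1                ∎
        where open ≤-Reasoning
      double : ∀ r → 4 * r + 1 + (4 * r + 1) ≡ 8 * r + 2
      double = ℕ-Solver.solve-∀

    translate-head-injective : ∀ {ξ ξs} → Chain V (ξ ∷ ξs) → ∀ {ρ σ} → ρ ∈ V → σ ∈ V →
      ∀ m ms n ns → m + Vec.sum ms ≤ r → n + Vec.sum ns ≤ r →
      res (translate ρ (ξ ∷ ξs) (m ∷ ms)) ≡ res (translate σ (ξ ∷ ξs) (n ∷ ns)) → m ≡ n
    translate-head-injective {ξ} {ξs} chain@(add {f} f-additive ξ∈V c≢0 maximal zeros _)
      {ρ} {σ} ρ∈V σ∈V m ms n ns Σms≤r Σns≤r eq =
      dominated-injective {value f ξ} {value f ρ} {value f σ} m n c≢0 (maximal ρ∈V) (maximal σ∈V)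
        (trans (sym (value-head ρ m ms)) (trans
          (≃⇒value≡ f-additive {translate ρ (ξ ∷ ξs) (m ∷ ms)} {translate σ (ξ ∷ ξs) (n ∷ ns)}
            (translate-≃ chain ρ∈V σ∈V (m ∷ ms) (n ∷ ns) Σms≤r Σns≤r eq))
          (value-head σ n ns)))
      where
      value-head : ∀ ρ n ns → value f (translate ρ (ξ ∷ ξs) (n ∷ ns)) ≡ + (3 * n) ℤ.* value f ξ ℤ.+ value f ρ
      value-head ρ n ns = trans (value-⊗ f-additive (power ξ (3 * n)) (translate ρ ξs ns))
        (cong₂ ℤ._+_ (value-power f-additive ξ (3 * n)) (value-translate f-additive ρ zeros ns))

    -- The hypothesis concerns residues and not rationals: after the head exponents are found equal,
    -- the common power is cancelled in the group, and the shorter products are compared in the same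
    -- way.
    translate-injective : ∀ {ξs} → Chain V ξs → ∀ {ρ σ} → ρ ∈ V → σ ∈ V →
      ∀ ms ns → Vec.sum ms ≤ r → Vec.sum ns ≤ r →
      res (translate ρ ξs ms) ≡ res (translate σ ξs ns) → res ρ ≡ res σ × ms ≡ ns
    translate-injective [] _ _ [] [] _ _ eq = eq , refl
    translate-injective {ξ ∷ ξs} chain@(add _ _ _ _ _ chain′) {ρ} {σ} ρ∈V σ∈V (m ∷ ms) (n ∷ ns) Σms≤r Σns≤r eq =
      tails (translate-head-injective chain ρ∈V σ∈V m ms n ns Σms≤r Σns≤r eq) eq
      where
      tails : ∀ {n} → m ≡ n → res (translate ρ (ξ ∷ ξs) (m ∷ ms)) ≡ res (translate σ (ξ ∷ ξs) (n ∷ ns)) →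
        res ρ ≡ res σ × _≡_ {A = Vec ℕ _} (m ∷ ms) (n ∷ ns)
      tails refl eq =
        let res≡ , ms≡ns = translate-injective chain′ ρ∈V σ∈V ms ns
              (≤-trans (m≤n+m _ m) Σms≤r) (≤-trans (m≤n+m _ n) Σns≤r)
              (⊗-cancelˡ-res (power ξ (3 * m)) (translate ρ ξs ms) (translate σ ξs ns) eq)
        in res≡ , cong (m ∷_) ms≡ns

-- Gaussian elimination on valuations.

-- Elimination finds pivots in no particular order, whereas the comparison with the first primes
-- needs a decreasing list.
insert-↘ : ∀ q {qs} → AllPairs _>_ qs → q ∉ qs → ∃[ qs′ ] (qs′ ↭ q ∷ qs × AllPairs _>_ qs′)
insert-↘ q [] _ = q ∷ [] , ↭-refl , [] ∷ []
insert-↘ q {q′ ∷ qs} (q′>qs ∷ qs↘) q∉ with <-cmp q q′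
... | tri≈ _ q≡q′ _ = contradiction (here q≡q′) q∉
... | tri> _ _ q>q′ =
  q ∷ q′ ∷ qs , ↭-refl , (q>q′ ∷ All.map (λ q′>q″ → <-trans q′>q″ q>q′) q′>qs) ∷ q′>qs ∷ qs↘
... | tri< q<q′ _ _ with qs′ , qs′↭ , qs′↘ ← insert-↘ q qs↘ (q∉ ∘ there) =
  q′ ∷ qs′ , ↭-trans (prep q′ qs′↭) (swap q′ q ↭-refl) ,
  All-resp-↭ (↭-sym qs′↭) (q<q′ ∷ q′>qs) ∷ qs′↘

-- Enlarging the pivot list to the exact length wanted takes the place of monotonicity of `Φ̃` in
-- its second argument. The new primes are put above the largest one.
pad-↘ : ∀ d {qs} → All Prime qs → AllPairs _>_ qs →
  ∃[ qs′ ] (All Prime qs′ × AllPairs _>_ qs′ × length qs′ ≡ d + length qs × qs ⊆ qs′)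
pad-↘ zero {qs} qs-prime qs↘ = qs , qs-prime , qs↘ , refl , λ q∈ → q∈
pad-↘ (suc d) qs-prime qs↘ with pad-↘ d qs-prime qs↘
... | [] , _ , _ , length≡ , qs⊆ = 2 ∷ [] , prime[2] ∷ [] , [] ∷ [] , cong suc length≡ , there ∘ qs⊆
... | q ∷ qs′ , qs′-prime , qs′↘@(q>qs′ ∷ _) , length≡ , qs⊆ =
  nextPrime q ∷ q ∷ qs′ , nextPrime-prime q ∷ qs′-prime ,
  (nextPrime> q ∷ All.map (λ q>q′ → <-trans q>q′ (nextPrime> q)) q>qs′) ∷ qs′↘ ,
  cong suc length≡ , there ∘ qs⊆

vℤ : ℕ → ℕ → ℤ
vℤ q n = + v q n

vℤ-additive : ∀ q → Additive (vℤ q)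
vℤ-additive q = additive λ m n → cong +_ (v-* q m n)

module Elimination {p t k : ℕ} (p-prime : Prime p) .{{_ : NonZero k}}
  {H : ℕ → Set} (isSubgroup : IsSubgroupOfOrder p t H) where

  open Fractions p-prime isSubgroup
  open Fraction

  eliminant : ℤ → ℤ → (ℕ → ℤ) → (ℕ → ℤ) → ℕ → ℤ
  eliminant c d f g n = c ℤ.* f n ℤ.- d ℤ.* g n

  eliminant-additive : ∀ c d {f g} → Additive f → Additive g → Additive (eliminant c d f g)
  eliminant-additive c d {f} {g} f-additive g-additive = additive λ m n →
    trans (cong₂ (λ i j → c ℤ.* i ℤ.- d ℤ.* j) (*-homo f-additive m n) (*-homo g-additive m n))
      (identity c d (f m) (f n) (g m) (g n))
    where
    open Additive
    identity : ∀ c d a a′ b b′ → c ℤ.* (a ℤ.+ a′) ℤ.- d ℤ.* (b ℤ.+ b′) ≡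
      (c ℤ.* a ℤ.- d ℤ.* b) ℤ.+ (c ℤ.* a′ ℤ.- d ℤ.* b′)
    identity = solve-∀

  value-eliminant : ∀ c d f g ρ → value (eliminant c d f g) ρ ≡ c ℤ.* value f ρ ℤ.- d ℤ.* value g ρ
  value-eliminant c d f g ρ = identity c d (f (∣num∣ ρ)) (f (den ρ)) (g (∣num∣ ρ)) (g (den ρ))
    where
    identity : ∀ c d a a′ b b′ → (c ℤ.* a ℤ.- d ℤ.* b) ℤ.- (c ℤ.* a′ ℤ.- d ℤ.* b′) ≡
      c ℤ.* (a ℤ.- a′) ℤ.- d ℤ.* (b ℤ.- b′)
    identity = solve-∀

  Agree : List ℕ → Fraction → Fraction → Set
  Agree Q ρ σ = All (λ q → value (vℤ q) ρ ≡ value (vℤ q) σ) Q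

  module _ (V : List Fraction) where

    Determines : List ℕ → Set
    Determines Q = ∀ {ρ σ} → ρ ∈ V → σ ∈ V → Agree Q ρ σ → ∀ q → Prime q → value (vℤ q) ρ ≡ value (vℤ q) σ

    -- Gaussian elimination on the valuations: Q is the list of pivots, F q is v_q reduced modulo the pivots.
    record State (ξs : List Fraction) (Q : List ℕ) : Set where
      field
        F          : ℕ → ℕ → ℤ
        F-additive : ∀ q → Additive (F q)
        chain      : Chain V ξs
        F-ξs       : ∀ q → All (λ ξ → value (F q) ξ ≡ 0ℤ) ξs
        F-Q        : ∀ {q} ρ → q ∈ Q → value (F q) ρ ≡ 0ℤ
        Q-prime    : All Prime Q
        Q↘         : AllPairs _>_ Q
        length≡    : length Q ≡ length ξs
        -- Among fractions that agree at the pivots, `F q` and the valuation at `q` separate the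
        -- same pairs. The converse direction `v⇒F` is what lets the next step compare `F q₀`.
        F⇒v        : ∀ q {ρ σ} → Agree Q ρ σ → value (F q) ρ ≡ value (F q) σ → value (vℤ q) ρ ≡ value (vℤ q) σ
        v⇒F        : ∀ q {ρ σ} → Agree Q ρ σ → value (vℤ q) ρ ≡ value (vℤ q) σ → value (F q) ρ ≡ value (F q) σ

    start : State [] []
    start = record
      { F = vℤ ; F-additive = vℤ-additive ; chain = [] ; F-ξs = λ _ → [] ; F-Q = λ _ ()
      ; Q-prime = [] ; Q↘ = [] ; length≡ = refl ; F⇒v = λ _ _ eq → eq ; v⇒F = λ _ _ eq → eq }

    -- The pivot is new, since `F q` vanishes on all fractions for `q` in `Q` but `F q₀` does not
    -- vanish at `ξ`. Subtracting the right multiple of `F q₀` kills `ξ`, and it keeps the earlier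
    -- zeros because `F q₀` is zero there too.
    step : ∀ {ξs Q} (S : State ξs Q) → ∀ {q₀ ξ} → Prime q₀ → ξ ∈ V → value (State.F S q₀) ξ ≢ 0ℤ →
      (∀ {ρ} → ρ ∈ V → ∣ value (State.F S q₀) ρ ∣ ≤ ∣ value (State.F S q₀) ξ ∣) → ∃[ Q′ ] State (ξ ∷ ξs) Q′
    step {ξs} {Q} S {q₀} {ξ} q₀-prime ξ∈V c≢0 maximal
      with Q′ , Q′↭ , Q′↘ ← insert-↘ q₀ (State.Q↘ S) (λ q₀∈Q → c≢0 (State.F-Q S ξ q₀∈Q)) = Q′ , record
      { F          = F′
      ; F-additive = λ q → eliminant-additive c (d q) (F-additive q) (F-additive q₀)
      ; chain      = add (F-additive q₀) ξ∈V c≢0 maximal (F-ξs q₀) chain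
      ; F-ξs       = λ q → trans (value-F′ q ξ)
                       (trans (cong (λ i → c ℤ.* d q ℤ.- i) (ℤ.*-comm (d q) c)) (ℤ.+-inverseʳ (c ℤ.* d q)))
                     ∷ All.zipWith (λ {ζ} (eq , eq₀) → F′≡0 q ζ eq (inj₂ eq₀)) (F-ξs q , F-ξs q₀)
      ; F-Q        = λ ρ q∈Q′ → F′-Q ρ (∈-resp-↭ Q′↭ q∈Q′)
      ; Q-prime    = All-resp-↭ (↭-sym Q′↭) (q₀-prime ∷ Q-prime)
      ; Q↘         = Q′↘
      ; length≡    = trans (↭-length Q′↭) (cong suc length≡)
      ; F⇒v        = λ q {ρ} {σ} agree → F′⇒v q {ρ} {σ} (All-resp-↭ Q′↭ agree)
      ; v⇒F        = λ q {ρ} {σ} agree → v⇒F′ q {ρ} {σ} (All-resp-↭ Q′↭ agree)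
      }
      where
      open State S
      c = value (F q₀) ξ
      d : ℕ → ℤ
      d q = value (F q) ξ
      F′ : ℕ → ℕ → ℤ
      F′ q = eliminant c (d q) (F q) (F q₀)
      value-F′ : ∀ q ρ → value (F′ q) ρ ≡ c ℤ.* value (F q) ρ ℤ.- d q ℤ.* value (F q₀) ρ
      value-F′ q ρ = value-eliminant c (d q) (F q) (F q₀) ρ
      F′≡0 : ∀ q ρ → value (F q) ρ ≡ 0ℤ → d q ≡ 0ℤ ⊎ value (F q₀) ρ ≡ 0ℤ → value (F′ q) ρ ≡ 0ℤ
      F′≡0 q ρ Fρ≡0 either = trans (value-F′ q ρ) (cong₂ ℤ._-_
        (trans (cong (c ℤ.*_) Fρ≡0) (ℤ.*-zeroʳ c)) (product≡0 either))
        where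
        product≡0 : d q ≡ 0ℤ ⊎ value (F q₀) ρ ≡ 0ℤ → d q ℤ.* value (F q₀) ρ ≡ 0ℤ
        product≡0 (inj₁ dq≡0) = cong (ℤ._* value (F q₀) ρ) dq≡0
        product≡0 (inj₂ F₀≡0) = trans (cong (d q ℤ.*_) F₀≡0) (ℤ.*-zeroʳ (d q))
      F′-Q : ∀ {q} ρ → q ∈ q₀ ∷ Q → value (F′ q) ρ ≡ 0ℤ
      F′-Q ρ (here refl)      = trans (value-F′ q₀ ρ) (ℤ.+-inverseʳ (c ℤ.* value (F q₀) ρ))
      F′-Q {q} ρ (there q∈Q)  = F′≡0 q ρ (F-Q ρ q∈Q) (inj₁ (F-Q ξ q∈Q))
      v⇒F′ : ∀ q {ρ σ} → Agree (q₀ ∷ Q) ρ σ → value (vℤ q) ρ ≡ value (vℤ q) σ → value (F′ q) ρ ≡ value (F′ q) σ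
      v⇒F′ q {ρ} {σ} (agree₀ ∷ agree) eq = trans (value-F′ q ρ) (trans
        (cong₂ (λ i j → c ℤ.* i ℤ.- d q ℤ.* j) (v⇒F q {ρ} {σ} agree eq) (v⇒F q₀ {ρ} {σ} agree agree₀))
        (sym (value-F′ q σ)))
      F′⇒v : ∀ q {ρ σ} → Agree (q₀ ∷ Q) ρ σ → value (F′ q) ρ ≡ value (F′ q) σ → value (vℤ q) ρ ≡ value (vℤ q) σ
      -- Agreement at `q₀` makes the subtracted terms equal; they are cancelled first, then the
      -- nonzero factor `c`.
      F′⇒v q {ρ} {σ} (agree₀ ∷ agree) eq = F⇒v q {ρ} {σ} agree
        (ℤ.*-cancelˡ-≡ c (value (F q) ρ) (value (F q) σ) {{ℤ.≢-nonZero c≢0}}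
          (∙-cancelʳ (AbelianGroup.group ℤ.+-0-abelianGroup) (ℤ.- (d q ℤ.* value (F q₀) ρ)) (c ℤ.* value (F q) ρ) (c ℤ.* value (F q) σ)
            (trans (sym (value-F′ q ρ)) (trans eq (trans (value-F′ q σ)
              (cong (λ i → c ℤ.* value (F q) σ ℤ.- d q ℤ.* i) (sym (v⇒F q₀ {ρ} {σ} agree agree₀))))))))

    -- Primes above `k` divide neither numerator nor denominator of a fraction in `V`, so only the
    -- finitely many primes up to `k` have to be searched for a pivot.
    reduced⇒determines : All (λ ρ → deg ρ ≡ 1) V → ∀ {ξs Q} (S : State ξs Q) →
      (∀ {q ρ} → q ≤ k → Prime q → ρ ∈ V → value (State.F S q) ρ ≡ 0ℤ) → Determines Q
    reduced⇒determines degs S F≡0 {ρ} {σ} ρ∈V σ∈V agree q q-prime with q ≤? k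
    ... | yes q≤k = State.F⇒v S q {ρ} {σ} agree (trans (F≡0 q≤k q-prime ρ∈V) (sym (F≡0 q≤k q-prime σ∈V)))
    ... | no q≰k  = trans (v≡0 ρ∈V) (sym (v≡0 σ∈V))
      where
      small : ∀ {n} → NonZero n → n ≤ k ^ 1 → v q n ≡ 0
      small {n} n≢0 n≤k = ∤⇒v≡0 n {{n≢0}} (>⇒∤ {{n≢0}} (≤-<-trans (subst (n ≤_) (*-identityʳ k) n≤k) (≰⇒> q≰k)))
      v≡0 : ∀ {ρ} → ρ ∈ V → value (vℤ q) ρ ≡ 0ℤ
      v≡0 {ρ} ρ∈V = cong₂ (λ a b → + a ℤ.- + b)
        (small (num≢0 ρ) (subst (λ d → ∣num∣ ρ ≤ k ^ d) (All.lookup degs ρ∈V) (num≤ ρ)))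
        (small (den≢0 ρ) (subst (λ d → den ρ ≤ k ^ d) (All.lookup degs ρ∈V) (den≤ ρ)))

    Pivot : (ℕ → ℕ → ℤ) → Set
    Pivot F = ∃[ q ] ∃[ ξ ] (Prime q × ξ ∈ V × value (F q) ξ ≢ 0ℤ ×
      (∀ {ρ} → ρ ∈ V → ∣ value (F q) ρ ∣ ≤ ∣ value (F q) ξ ∣))

    maximal-pivot : ∀ F {q ρ} → Prime q → ρ ∈ V → value (F q) ρ ≢ 0ℤ → Pivot F
    maximal-pivot F {q} {ρ} q-prime ρ∈V ρ≢0 = q , ξ , q-prime , ξ∈V , ξ≢0 , maximal
      where
      ξ = argmax (λ ρ → ∣ value (F q) ρ ∣) ρ V
      ξ∈V : ξ ∈ V
      ξ∈V with argmax-sel (λ ρ → ∣ value (F q) ρ ∣) ρ V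
      ... | inj₁ ξ≡ρ = subst (_∈ V) (sym ξ≡ρ) ρ∈V
      ... | inj₂ ξ∈  = ξ∈
      maximal : ∀ {σ} → σ ∈ V → ∣ value (F q) σ ∣ ≤ ∣ value (F q) ξ ∣
      maximal σ∈V = All.lookup (f[xs]≤f[argmax] {f = λ ρ → ∣ value (F q) ρ ∣} ρ V) σ∈V
      ξ≢0 : value (F q) ξ ≢ 0ℤ
      ξ≢0 ξ≡0 = ρ≢0 (ℤ.∣i∣≡0⇒i≡0 (n≤0⇒n≡0 (≤-trans (maximal ρ∈V) (≤-reflexive (cong ∣_∣ ξ≡0)))))

    pivot? : ∀ F → Pivot F ⊎ (∀ {q ρ} → q ≤ k → Prime q → ρ ∈ V → value (F q) ρ ≡ 0ℤ)
    pivot? F with any? (λ q → prime? q ×-dec any? (λ ρ → ¬? (value (F q) ρ ℤ.≟ 0ℤ)) V) (upTo (suc k))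
    ... | no ¬pivot = inj₂ λ q≤k q-prime ρ∈V → decidable-stable (_ ℤ.≟ 0ℤ) λ ≢0 →
            ¬pivot (lose (∈-upTo⁺ (s≤s q≤k)) (q-prime , lose ρ∈V ≢0))
    ... | yes pivot = let q , _ , q-prime , nonzero = find pivot
                          ρ , ρ∈V , ρ≢0 = find nonzero
                      in inj₁ (maximal-pivot F {q} {ρ} q-prime ρ∈V ρ≢0)

    -- `s` is the number of steps still to be made. Getting stuck earlier means that all reduced
    -- valuations vanish on `V`, and then the pivots found so far, one for each fraction, determine
    -- everything.
    eliminate : All (λ ρ → deg ρ ≡ 1) V → ∀ s {ξs Q} → State ξs Q →
      (∃[ ξs′ ] (Chain V ξs′ × length ξs′ ≡ s + length ξs)) ⊎
      (∃[ Q′ ] (All Prime Q′ × AllPairs _>_ Q′ × length Q′ < s + length ξs × Determines Q′))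
    eliminate degs zero {ξs} S = inj₁ (ξs , State.chain S , refl)
    eliminate degs (suc s) {ξs} {Q} S with pivot? (State.F S)
    ... | inj₂ reduced = inj₂ (Q , State.Q-prime S , State.Q↘ S ,
            s≤s (≤-trans (≤-reflexive (State.length≡ S)) (m≤n+m (length ξs) s)) ,
            reduced⇒determines degs S reduced)
    ... | inj₁ (q , ξ , q-prime , ξ∈V , ξ≢0 , maximal)
      with eliminate degs s (proj₂ (step S q-prime ξ∈V ξ≢0 maximal))
    ... | inj₁ (ξs′ , chain′ , length≡′) = inj₁ (ξs′ , chain′ , trans length≡′ (+-suc s (length ξs)))
    ... | inj₂ (Q′ , Q′-prime , Q′↘ , length< , determines) =
      inj₂ (Q′ , Q′-prime , Q′↘ , subst (length Q′ <_) (+-suc s (length ξs)) length< , determines)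

-- The two counting bounds and their combination.

+-∸-injective : ∀ {a b c d} → b ≤ a → d ≤ c → a ∸ b ≡ c ∸ d → + a ℤ.- + b ≡ + c ℤ.- + d
+-∸-injective {a} {b} {c} {d} b≤a d≤c eq = begin
  + a ℤ.- + b   ≡⟨ ℤ.m-n≡m⊖n a b ⟩
  a ℤ.⊖ b       ≡⟨ ℤ.⊖-≥ b≤a ⟩
  + (a ∸ b)     ≡⟨ cong +_ eq ⟩
  + (c ∸ d)     ≡⟨ ℤ.⊖-≥ d≤c ⟨
  c ℤ.⊖ d       ≡⟨ ℤ.m-n≡m⊖n c d ⟨
  + c ℤ.- + d   ∎
  where open ≡-Reasoning

∸-+-injective : ∀ {a b c d} → a ≤ b → c ≤ d → b ∸ a ≡ d ∸ c → + a ℤ.- + b ≡ + c ℤ.- + d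
∸-+-injective {a} {b} {c} {d} a≤b c≤d eq = begin
  + a ℤ.- + b      ≡⟨ ℤ.m-n≡m⊖n a b ⟩
  a ℤ.⊖ b          ≡⟨ ℤ.⊖-≤ a≤b ⟩
  ℤ.- + (b ∸ a)    ≡⟨ cong (λ n → ℤ.- + n) eq ⟩
  ℤ.- + (d ∸ c)    ≡⟨ ℤ.⊖-≤ c≤d ⟨
  c ℤ.⊖ d          ≡⟨ ℤ.m-n≡m⊖n c d ⟨
  + c ℤ.- + d      ∎
  where open ≡-Reasoning

difference≡⇒+≡ : ∀ a b c d → + a ℤ.- + b ≡ + c ℤ.- + d → a + d ≡ c + b
difference≡⇒+≡ a b c d eq = ℤ.+-injective (begin
  + a ℤ.+ + d                         ≡⟨ lhs (+ a) (+ b) (+ d) ⟩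
  (+ a ℤ.- + b) ℤ.+ + b ℤ.+ + d       ≡⟨ cong (λ i → i ℤ.+ + b ℤ.+ + d) eq ⟩
  (+ c ℤ.- + d) ℤ.+ + b ℤ.+ + d       ≡⟨ rhs (+ c) (+ d) (+ b) ⟩
  + c ℤ.+ + b                         ∎)
  where
  open ≡-Reasoning
  lhs : ∀ a b d → a ℤ.+ d ≡ (a ℤ.- b) ℤ.+ b ℤ.+ d
  lhs = solve-∀
  rhs : ∀ c d b → (c ℤ.- d) ℤ.+ b ℤ.+ d ≡ c ℤ.+ b
  rhs = solve-∀

◃-*-+ : ∀ i n → i ℤ.* + n ≡ ℤ.sign i ◃ (∣ i ∣ * n)
◃-*-+ i n = begin
  i ℤ.* + n                                 ≡⟨ cong₂ ℤ._*_ (ℤ.signᵢ◃∣i∣≡i i) (ℤ.+◃n≡+n n) ⟨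
  (ℤ.sign i ◃ ∣ i ∣) ℤ.* (Sign.+ ◃ n)       ≡⟨ ℤ.◃-distrib-* (ℤ.sign i) Sign.+ ∣ i ∣ n ⟨
  (ℤ.sign i Sign.* Sign.+) ◃ (∣ i ∣ * n)    ≡⟨ cong (_◃ (∣ i ∣ * n)) (Sign.*-identityʳ (ℤ.sign i)) ⟩
  ℤ.sign i ◃ (∣ i ∣ * n)                    ∎
  where open ≡-Reasoning

module Counting {p t k r : ℕ} (p-prime : Prime p) (2<p : 2 < p) .{{_ : NonZero k}}
  {H : ℕ → Set} (isSubgroup : IsSubgroupOfOrder p t H) (bound : 2 * k ^ (8 * r + 2) ≤ p) where

  open Fractions p-prime isSubgroup
  open Fraction
  open Elimination p-prime isSubgroup
  open IsSubgroupOfOrder isSubgroup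

  k<p : k < p
  k<p = begin-strict
    k                    <⟨ m<m+n k (>-nonZero⁻¹ k) ⟩
    k + k                ≡⟨ cong (_+_ k) (+-identityʳ k) ⟨
    2 * k                ≡⟨ cong (2 *_) (*-identityʳ k) ⟨
    2 * k ^ 1            ≤⟨ *-monoʳ-≤ 2 (^-monoʳ-≤ k (≤-trans (s≤s z≤n) (m≤n+m 2 (8 * r)))) ⟩
    2 * k ^ (8 * r + 2)  ≤⟨ bound ⟩
    p                    ∎
    where open ≤-Reasoning

  ≤k⇒p∤ : ∀ {n} .{{_ : NonZero n}} → n ≤ k → p ∤ n
  ≤k⇒p∤ n≤k = >⇒∤ (≤-<-trans n≤k k<p)

  fraction : ∀ x → InV p k H x → ∃[ ρ ] (res ρ ≡ x × deg ρ ≡ 1)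
  fraction x (x∈H , a , b , 1≤b , ∣a∣≤k , b≤k , p∣) = record
    { res = x ; deg = 1 ; den = b ; num = a ; res∈H = x∈H
    ; num≢0 = ≢-nonZero a≢0
    ; den≢0 = >-nonZero 1≤b
    ; num≤ = subst (∣ a ∣ ≤_) (sym (*-identityʳ k)) ∣a∣≤k
    ; den≤ = subst (b ≤_) (sym (*-identityʳ k)) b≤k
    ; num≡ = subst (λ i → + p ℤ∣.∣ a ℤ.- i) (ℤ.pos-* b x) (ℤ∣.∣ᵤ⇒∣ p∣) } , refl , refl
    where
    p∣bx : ∀ a → ∣ a ∣ ≡ 0 → p ∣ ∣ a ℤ.- + (b * x) ∣ → p ∣ b * x
    p∣bx (+ zero) _ = subst (p ∣_) (trans (cong ∣_∣ (ℤ.+-identityˡ (ℤ.- (+ (b * x))))) (ℤ.∣-i∣≡∣i∣ (+ (b * x))))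
    -- A zero numerator would force `p` to divide b or x, but b ≤ k < p and x is a nonzero residue.
    a≢0 : ∣ a ∣ ≢ 0
    a≢0 ∣a∣≡0 with euclidsLemma b x p-prime (p∣bx a ∣a∣≡0 p∣)
    ... | inj₁ p∣b = ≤k⇒p∤ {{>-nonZero 1≤b}} b≤k p∣b
    ... | inj₂ p∣x = >⇒∤ {{>-nonZero (proj₁ (inUnits x x∈H))}} (proj₂ (inUnits x x∈H)) p∣x

  fractions : ∀ L → All (InV p k H) L → ∃[ V ] (map res V ≡ L × All (λ ρ → deg ρ ≡ 1) V)
  fractions [] [] = [] , refl , []
  fractions (x ∷ L) (x∈V ∷ L⊆V) with fraction x x∈V | fractions L L⊆V
  ... | ρ , refl , deg≡1 | V , refl , degs = ρ ∷ V , refl , deg≡1 ∷ degs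

  module _ {V : List Fraction} (degs : All (λ ρ → deg ρ ≡ 1) V) (V! : Unique (map res V)) where

    -- Pairs of a residue from `V` and an exponent vector are sent injectively into the subgroup;
    -- the binomial coefficient is the number of vectors.
    translates-bound : ∀ {ξs} → Chain V ξs → ((r + length ξs) C length ξs) * length (map res V) ≤ t
    translates-bound {ξs} chain with G , G! , G⇔H , length≡t ← order = begin
      ((r + s) C s) * length (map res V)
        ≡⟨ cong (_* length (map res V)) (length-exponents s r) ⟨
      length (exponents s r) * length (map res V)
        ≡⟨ *-comm (length (exponents s r)) _ ⟩
      length (map res V) * length (exponents s r)
        ≡⟨ length-cartesianProduct (map res V) (exponents s r) ⟨
      length (cartesianProduct (map res V) (exponents s r))
        ≤⟨ pigeonhole R (Unique.cartesianProduct⁺ V! (exponents-unique s r)) total injective ⟩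
      length G
        ≡⟨ length≡t ⟩
      t ∎
      where
      open ≤-Reasoning
      s = length ξs
      R : ℕ × Vec ℕ s → ℕ → Set
      R (x , ns) y = ∃[ ρ ] (ρ ∈ V × res ρ ≡ x × Vec.sum ns ≤ r × y ≡ res (translate ρ ξs ns))
      total : ∀ {xns} → xns ∈ cartesianProduct (map res V) (exponents s r) → ∃[ y ] (y ∈ G × R xns y)
      total {x , ns} xns∈
        with x∈ , ns∈ ← ∈-cartesianProduct⁻ (map res V) (exponents s r) xns∈
        with ρ , ρ∈V , x≡ ← ∈-map⁻ res x∈ =
        res (translate ρ ξs ns) , Equivalence.from (G⇔H _) (res∈H (translate ρ ξs ns)) ,
        ρ , ρ∈V , sym x≡ , sum-exponents s r ns∈ , refl
      injective : ∀ {xns xns′ y} → xns ∈ _ → xns′ ∈ _ → R xns y → R xns′ y → xns ≡ xns′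
      injective {_ , ms} {_ , ns} _ _ (ρ , ρ∈V , refl , Σms≤r , refl) (σ , σ∈V , refl , Σns≤r , eq) =
        let res≡ , ms≡ns = translate-injective 2<p bound degs chain ρ∈V σ∈V ms ns Σms≤r Σns≤r eq
        in cong₂ _,_ res≡ ms≡ns

    module _ {Q : List ℕ} (Q-prime : All Prime Q) (Q↘ : AllPairs _>_ Q) where

      vn vd : Fraction → ℕ → ℕ
      vn ρ q = v q (∣num∣ ρ)
      vd ρ q = v q (den ρ)

      positive? : ∀ ρ → Decidable (λ q → vd ρ q < vn ρ q)
      positive? ρ q = vd ρ q <? vn ρ q

      -- Pivots of exponent zero land in `neg`, where they contribute the factor 1.
      pos neg : Fraction → List ℕ
      pos ρ = filter (positive? ρ) Q
      neg ρ = filter (¬? ∘ positive? ρ) Q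

      numCode denCode : Fraction → ℕ
      numCode ρ = compress (λ q → vn ρ q ∸ vd ρ q) (pos ρ)
      denCode ρ = compress (λ q → vd ρ q ∸ vn ρ q) (neg ρ)

      code : Fraction → Code
      code ρ = (pos ρ , neg ρ) , (numCode ρ , denCode ρ)

      -- Three replacements, none of which increases the integer: discarding other primes from `n`,
      -- lowering exponents, and passing to the first primes.
      compress≤k : ∀ {e n} → NonZero n → n ≤ k → (∀ q → e q ≤ v q n) → ∀ {P : ℕ → Set} (P? : Decidable P) →
        compress e (filter P? Q) ≤ k
      compress≤k {e} {n} n≢0 n≤k e≤v P? = begin
        compress e (filter P? Q)                  ≤⟨ compress≤primePowers e prime↾ ↘↾ ⟩
        primePowers e (filter P? Q)               ≤⟨ primePowers-mono prime↾ e≤v ⟩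
        primePowers (λ q → v q n) (filter P? Q)   ≤⟨ primePowers-v≤ n {{n≢0}} (AllPairs.map >⇒≢ ↘↾) ⟩
        n                                         ≤⟨ n≤k ⟩
        k                                         ∎
        where
        open ≤-Reasoning
        prime↾ = All.filter⁺ P? Q-prime
        ↘↾ = AllPairs.filter⁺ P? Q↘

      num≤k : ∀ {ρ} → ρ ∈ V → ∣num∣ ρ ≤ k
      num≤k {ρ} ρ∈V = subst (∣num∣ ρ ≤_) (trans (cong (k ^_) (All.lookup degs ρ∈V)) (*-identityʳ k)) (num≤ ρ)

      den≤k : ∀ {ρ} → ρ ∈ V → den ρ ≤ k
      den≤k {ρ} ρ∈V = subst (den ρ ≤_) (trans (cong (k ^_) (All.lookup degs ρ∈V)) (*-identityʳ k)) (den≤ ρ)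

      code∈codes : ∀ {ρ} → ρ ∈ V → code ρ ∈ codes k Q
      code∈codes {ρ} ρ∈V = ∈-codes {qs = Q} (filter∈splits (positive? ρ) Q)
        (compress∈smooths _ (pos ρ) (compress≤k (num≢0 ρ) (num≤k ρ∈V) (λ q → m∸n≤m (vn ρ q) (vd ρ q)) (positive? ρ)))
        (compress∈smooths _ (neg ρ) (compress≤k (den≢0 ρ) (den≤k ρ∈V) (λ q → m∸n≤m (vd ρ q) (vn ρ q)) (¬? ∘ positive? ρ)))

      -- Equal codes have the same parts, so compression can be undone. On each part the sign of the
      -- exponent is known, and the truncated difference therefore gives the true one.
      code-injective : ∀ ρ σ → code ρ ≡ code σ → Agree Q ρ σ
      code-injective ρ σ eq = All.filter⁻ (positive? ρ)
        (All.zipWith (λ (b<a , d<c , e≡) → +-∸-injective (<⇒≤ b<a) (<⇒≤ d<c) e≡)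
          (All.all-filter (positive? ρ) Q , All.zip
            (subst (All _) (sym pos≡) (All.all-filter (positive? σ) Q) ,
             compress-injective _ _ (pos ρ) (trans (cong (proj₁ ∘ proj₂) eq) (cong (compress _) (sym pos≡))))))
        (All.zipWith (λ (b≮a , d≮c , e≡) → ∸-+-injective (≮⇒≥ b≮a) (≮⇒≥ d≮c) e≡)
          (All.all-filter (¬? ∘ positive? ρ) Q , All.zip
            (subst (All _) (sym neg≡) (All.all-filter (¬? ∘ positive? σ) Q) ,
             compress-injective _ _ (neg ρ) (trans (cong (proj₂ ∘ proj₂) eq) (cong (compress _) (sym neg≡))))))
        where
        pos≡ : pos ρ ≡ pos σ
        pos≡ = cong (proj₁ ∘ proj₁) eq
        neg≡ : neg ρ ≡ neg σ
        neg≡ = cong (proj₂ ∘ proj₁) eq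

      -- Unique factorisation applied to the two cross products; the sign is the only datum that
      -- valuations miss.
      agree⇒≃ : ∀ ρ σ → ℤ.sign (num ρ) ≡ ℤ.sign (num σ) →
        (∀ q → Prime q → value (vℤ q) ρ ≡ value (vℤ q) σ) → ρ ≃ σ
      agree⇒≃ ρ σ sign≡ agree = begin
        num ρ ℤ.* + den σ                         ≡⟨ ◃-*-+ (num ρ) (den σ) ⟩
        ℤ.sign (num ρ) ◃ (∣num∣ ρ * den σ)        ≡⟨ cong₂ _◃_ sign≡ (v-injective (∣num∣ ρ * den σ) (∣num∣ σ * den ρ)
                                                       {{m*n≢0 _ _ {{num≢0 ρ}} {{den≢0 σ}}}}
                                                       {{m*n≢0 _ _ {{num≢0 σ}} {{den≢0 ρ}}}} v≡) ⟩
        ℤ.sign (num σ) ◃ (∣num∣ σ * den ρ)        ≡⟨ ◃-*-+ (num σ) (den ρ) ⟨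
        num σ ℤ.* + den ρ                         ∎
        where
        open ≡-Reasoning
        v≡ : ∀ q → Prime q → v q (∣num∣ ρ * den σ) ≡ v q (∣num∣ σ * den ρ)
        v≡ q q-prime = begin
          v q (∣num∣ ρ * den σ)  ≡⟨ v-* q (∣num∣ ρ) (den σ) {{num≢0 ρ}} {{den≢0 σ}} ⟩
          vn ρ q + vd σ q        ≡⟨ difference≡⇒+≡ (vn ρ q) (vd ρ q) (vn σ q) (vd σ q) (agree q q-prime) ⟩
          vn σ q + vd ρ q        ≡⟨ v-* q (∣num∣ σ) (den ρ) {{num≢0 σ}} {{den≢0 ρ}} ⟨
          v q (∣num∣ σ * den ρ)  ∎

      codes-bound : Determines V Q → length (map res V) ≤ 2 * Φ̃ k (length Q)
      codes-bound determines = begin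
        length (map res V)                                   ≤⟨ pigeonhole R V! total injective ⟩
        length (cartesianProduct signs (codes k Q))          ≡⟨ length-cartesianProduct signs (codes k Q) ⟩
        2 * length (codes k Q)                               ≡⟨ cong (2 *_) (length-codes k Q) ⟩
        2 * Φ̃ k (length Q)                                   ∎
        where
        open ≤-Reasoning
        signs = Sign.+ ∷ Sign.- ∷ []
        R : ℕ → Sign × Code → Set
        R x c = ∃[ ρ ] (ρ ∈ V × x ≡ res ρ × c ≡ (ℤ.sign (num ρ) , code ρ))
        ∈-signs : ∀ s → s ∈ signs
        ∈-signs Sign.+ = here refl
        ∈-signs Sign.- = there (here refl)
        total : ∀ {x} → x ∈ map res V → ∃[ c ] (c ∈ cartesianProduct signs (codes k Q) × R x c)
        total x∈ with ρ , ρ∈V , x≡ ← ∈-map⁻ res x∈ =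
          _ , ∈-cartesianProduct⁺ (∈-signs (ℤ.sign (num ρ))) (code∈codes ρ∈V) , ρ , ρ∈V , x≡ , refl
        injective : ∀ {x x′ c} → x ∈ map res V → x′ ∈ map res V → R x c → R x′ c → x ≡ x′
        injective _ _ (ρ , ρ∈V , refl , c≡) (σ , σ∈V , refl , c≡′) =
          ≃⇒res≡ {ρ} {σ} (≤k⇒p∤ {{den≢0 ρ}} (den≤k ρ∈V)) (≤k⇒p∤ {{den≢0 σ}} (den≤k σ∈V))
            (agree⇒≃ ρ σ (cong proj₁ ≡c)
              (determines ρ∈V σ∈V (code-injective ρ σ (cong proj₂ ≡c))))
          where ≡c = trans (sym c≡) c≡′

    dichotomy : ∀ s → length (map res V) ≤ 2 * Φ̃ k s ⊎ ((r + suc s) C suc s) * length (map res V) ≤ t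
    dichotomy s with eliminate V degs (suc s) (start V)
    ... | inj₁ (ξs , chain , length≡) = inj₂ (subst (λ n → ((r + n) C n) * length (map res V) ≤ t)
            (trans length≡ (+-identityʳ (suc s))) (translates-bound chain))
    ... | inj₂ (Q , Q-prime , Q↘ , length< , determines)
      -- `Q` has fewer than `suc s` primes and is padded to exactly `s`; a larger set of primes
      -- still determines the fraction up to sign.
      with Q′ , Q′-prime , Q′↘ , length≡ , Q⊆Q′ ← pad-↘ (s ∸ length Q) Q-prime Q↘ =
      inj₁ (subst (λ n → length (map res V) ≤ 2 * Φ̃ k n)
        (trans length≡ (m∸n+n≡m (≤-pred (subst (length Q <_) (+-identityʳ (suc s)) length<))))
        (codes-bound Q′-prime Q′↘ λ {ρ} {σ} ρ∈V σ∈V agree →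
          determines ρ∈V σ∈V (All.anti-mono Q⊆Q′ agree)))

  small-height-bound : ∀ {L} → Unique L → All (InV p k H) L → ∀ s →
    length L ≤ 2 * Φ̃ k s ⊎ ((r + suc s) C suc s) * length L ≤ t
  small-height-bound {L} L! L⊆V with V , refl , degs ← fractions L L⊆V = dichotomy degs L!

theorem1p8 : (p t k s : ℕ) → Prime p → 2 < p → t ∣ p ∸ 1 → 1 ≤ t → 1 < k → 1 ≤ s →
    (H : ℕ → Set) → IsSubgroupOfOrder p t H →
    (r : ℤ) → IsR2 p k r →
    (L : List ℕ) → Unique L → (∀ x → (x ∈ L) ⇔ InV p k H x) →
    length L ≤ 2 * Φ̃ k (s ∸ 1) ⊎ binomℤ (r ℤ.+ + s) s * length L ≤ t
theorem1p8 p t k (suc s) _ _ _ _ _ _ _ _ _ (inj₁ (refl , _)) L _ _ =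
  -- For r = -1 the upper entry is one less than the lower one, so the binomial coefficient is 0 and
  -- the second bound is trivial.
  inj₂ (≤-trans (≤-reflexive (cong (_* length L) (k>n⇒nCk≡0 (n<1+n s)))) z≤n)
theorem1p8 p t k (suc s) p-prime 2<p _ _ 1<k _ H isSubgroup _ (inj₂ (r , refl , bound , _)) L L! L⇔V =
  Counting.small-height-bound {k = k} {r} p-prime 2<p {{>-nonZero (<-trans z<s 1<k)}} isSubgroup bound L!
    (All.tabulate λ {x} → Equivalence.to (L⇔V x)) s
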